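{- For every integer $t$, there is an integer $d$ such that every graph that does not contain $K_t$ as a strong immersion is $2$-colourable with defect $d$.
   Context: All graphs are finite and simple. A graph $G$ contains $H$ as an immersion if the vertices of $H$ can be mapped to distinct vertices of $G$ (the branch vertices) and the edges of $H$ to pairwise edge-disjoint paths in $G$ such that each edge $vw$ of $H$ is mapped to a path whose endpoints are the images of $v$ and $w$. It is a strong immersion if moreover no internal vertex of any of these paths is a branch vertex. A graph is $k$-colourable with defect $d$ if its vertices can be given one of $k$ colours (not necessarily properly) so that each vertex has at most $d$ neighbours of its own colour. -}

module Defs where

open import Data.Nat using (ℕ; _<_; _≤_)
open import Data.Fin using (Fin) renaming (_<_ to _<ᶠ_)
open import Data.Fin.Properties using (_≟_)
open import Data.Bool using (Bool; true; false; _∧_)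
open import Data.List using (List; []; _∷_; _++_; [_]; length; filter; allFin)
open import Data.List.Membership.Propositional using (_∈_)
open import Data.List.Relation.Unary.Linked using (Linked)
open import Data.List.Relation.Unary.Unique.Propositional using (Unique)
open import Data.Product using (_×_; Σ; ∃)
open import Function.Definitions using (Injective)
open import Relation.Binary.PropositionalEquality using (_≡_; _≢_)
open import Relation.Nullary using (¬_)

record Graph : Set where
  field
    size   : ℕ
    adj    : Fin size → Fin size → Bool
    sym    : ∀ u v → adj u v ≡ adj v u
    irrefl : ∀ v → adj v v ≡ false

open Graph public

Vertex : Graph → Set
Vertex G = Fin (size G)

Adj : (G : Graph) → Vertex G → Vertex G → Set
Adj G u v = adj G u v ≡ true

IsPath : (G : Graph) → List (Vertex G) → Set
IsPath G xs = Unique xs × Linked (Adj G) xs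

data EdgeOf {A : Set} : List A → A → A → Set where
  fwd   : ∀ {x y xs} → EdgeOf (x ∷ y ∷ xs) x y
  bwd   : ∀ {x y xs} → EdgeOf (x ∷ y ∷ xs) y x
  there : ∀ {x xs u v} → EdgeOf xs u v → EdgeOf (x ∷ xs) u v

-- A strong immersion of the complete graph K_t in G.
-- branch i is the branch vertex of vertex i of K_t; for i < j the edge ij of
-- K_t is mapped to the path  branch i ∷ inner i j ++ [ branch j ]
-- (inner i j = list of internal vertices of that path).
record StrongImmersionK (t : ℕ) (G : Graph) : Set where
  field
    branch   : Fin t → Vertex G
    injective : Injective _≡_ _≡_ branch
    inner    : Fin t → Fin t → List (Vertex G)
  route : Fin t → Fin t → List (Vertex G)
  route i j = branch i ∷ (inner i j ++ [ branch j ])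
  field
    isPath   : ∀ i j → i <ᶠ j → IsPath G (route i j)
    strong   : ∀ i j → i <ᶠ j → ∀ v → v ∈ inner i j → ∀ k → v ≢ branch k
    edgeDisjoint : ∀ i j k l → i <ᶠ j → k <ᶠ l → ¬ (i ≡ k × j ≡ l) →
                   ∀ u v → EdgeOf (route i j) u v → ¬ EdgeOf (route k l) u v

sameColourNbrs : ∀ {k} (G : Graph) → (Vertex G → Fin k) → Vertex G → ℕ
sameColourNbrs G c v =
  length (filter (λ u → Data.Bool.T? (adj G v u) Relation.Nullary.×-dec (c u ≟ c v))
                 (allFin (size G)))
  where import Data.Bool
        import Relation.Nullary

ColourableWithDefect : Graph → ℕ → ℕ → Set
ColourableWithDefect G k d =
  Σ (Vertex G → Fin k) λ c → ∀ v → sameColourNbrs G c v ≤ d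

{-# OPTIONS --safe #-}

-- Let K = t². Call an edge uv weak if some edge cut of size less than K separates u from v.
--
-- A vertex v with many strong neighbours is the hub of a strong immersion of K_t. Each strong
-- neighbour u sends K arc-disjoint paths to v, which can be chosen to touch at most K neighbours
-- of v, since a path reaching a neighbour of v may stop there. Hence among many strong
-- neighbours there are t whose path systems avoid each other. By Menger's theorem all t of them
-- can simultaneously be joined to v by t edge-disjoint paths each, none passing through another
-- branch vertex, and these paths are concatenated at v.
--
-- The weak edges form a graph in which every edge lies in a small cut. A Gomory–Hu
-- decomposition splits it along small cuts into independent sets arranged in a rooted tree.
-- Going down the tree, each part gets one colour: if edges leave the parent's subtree from the
-- child's subtree, the child inherits the colour prescribed for the parent, otherwise it gets
-- the opposite of the parent's colour. The first case concerns few children, and each child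
-- has few edges to its parent.
module Submission where

open import Defs hiding (sym)
open import Algebra.Properties.CommutativeMonoid.Sum
  using (sum; sum-cong-≗; ∑-distrib-+; ∑-comm; sum-replicate-zero)
open import Data.Bool using (Bool; true; false; _∧_; _∨_; not; if_then_else_; T; T?)
open import Data.Bool.Properties
  using (∧-identityʳ; ∧-zeroʳ; T-∧; not-involutive; ¬-not; not-¬)
  renaming (_≟_ to _≟ᵇ_)
open import Data.Empty using (⊥; ⊥-elim)
open import Data.Fin as Fin using (Fin; zero; suc; combine; remQuot)
open import Data.Fin.Properties using (_≟_; any?; all?; suc-injective; combine-injective; remQuot-combine)
open import Data.Fin.Subset.Properties using (anySubset?)
open import Data.List as List using (List; []; _∷_; _++_; [_]; allFin; filter; length)
open import Data.List.Membership.Propositional using (_∈_)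
open import Data.List.Membership.Propositional.Properties using (∈-allFin; ∈-filter⁺; ∈-++⁺ˡ; ∈-++⁺ʳ)
open import Data.List.Relation.Unary.All as All using (All; []; _∷_)
open import Data.List.Relation.Unary.All.Properties as All using (¬Any⇒All¬)
open import Data.List.Relation.Unary.AllPairs as AllPairs using (AllPairs; []; _∷_)
import Data.List.Relation.Unary.AllPairs.Properties as AllPairs
open import Data.List.Relation.Unary.Any as Any using (here; there)
open import Data.List.Relation.Unary.Linked as Linked using (Linked; []; [-]; _∷_)
open import Data.List.Relation.Unary.Unique.Propositional using (Unique)
open import Data.Nat hiding (_≟_; _≤?_; _<?_)
open import Data.Nat.Properties hiding (_≟_; _≤?_; _<?_; suc-injective)
open import Data.Nat.Properties using () renaming (_≤?_ to _≤ⁿ?_; _<?_ to _<ⁿ?_)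
open import Data.Product using (∃; _×_; _,_; proj₁; proj₂; swap)
open import Data.Sum using (_⊎_; inj₁; inj₂; [_,_]′)
open import Data.Unit using (tt)
open import Data.Vec using (lookup; tabulate)
open import Data.Vec.Functional using (updateAt)
open import Data.Vec.Functional.Properties using (updateAt-updates; updateAt-minimal)
open import Data.Vec.Properties using (lookup∘tabulate)
open import Function using (_∘_; const; Equivalence; mk⇔)
open import Relation.Binary.PropositionalEquality
  using (_≡_; _≢_; _≗_; refl; sym; trans; cong; cong₂; subst; subst₂)
open import Relation.Binary.Construct.Closure.ReflexiveTransitive as Star using (Star; ε; _◅_; _◅◅_)
open import Relation.Nullary using (¬_; ¬?; Dec; yes; no; does; contradiction; _×-dec_; _→-dec_)
open import Relation.Nullary.Decidable using (decidable-stable; dec-true; dec-false; does-⇔; map′)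

-- Counting, edge counts and cut functions.

private
  variable
    m n k N : ℕ

  Σℕ : (Fin n → ℕ) → ℕ
  Σℕ = sum +-0-commutativeMonoid

ι : Bool → ℕ
ι b = if b then 1 else 0

VSet : ℕ → Set
VSet n = Fin n → Bool

Arcs : ℕ → Set
Arcs n = Fin n → Fin n → Bool

count : VSet n → ℕ
count P = Σℕ λ v → ι (P v)

Σ₂ : (Fin m → Fin n → ℕ) → ℕ
Σ₂ f = Σℕ λ a → Σℕ (f a)

edges : Arcs n → VSet n → VSet n → ℕ
edges D S R = Σ₂ λ a b → ι (S a ∧ D a b ∧ R b)

cut : Arcs n → VSet n → ℕ
cut D S = edges D S (not ∘ S)

BoolFun : ℕ → Set
BoolFun zero    = Bool
BoolFun (suc n) = Bool → BoolFun n

table : ∀ n → BoolFun n → Bool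
table zero    b = b
table (suc n) f = table n (f true) ∧ table n (f false)

Valid : ∀ n → BoolFun n → Set
Valid zero    b = T b
Valid (suc n) f = ∀ x → Valid n (f x)

-- Proof by reflection: an inequality between the contributions of a single arc or token depends on
-- a few Booleans only, so evaluating its truth table proves it with `tt`.
taut : ∀ n (f : BoolFun n) → T (table n f) → Valid n f
taut zero    f t       = t
taut (suc n) f t true  = taut n (f true) (proj₁ (Equivalence.to T-∧ t))
taut (suc n) f t false = taut n (f false) (proj₂ (Equivalence.to T-∧ t))

∧-intro : ∀ {a b} → a ≡ true → b ≡ true → a ∧ b ≡ true
∧-intro refl refl = refl

∧-elim : ∀ a {b} → a ∧ b ≡ true → a ≡ true × b ≡ true
∧-elim true e = refl , e

∨-elim : ∀ a {b} → a ∨ b ≡ true → a ≡ true ⊎ b ≡ true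
∨-elim true  e = inj₁ refl
∨-elim false e = inj₂ e

∧-zero : ∀ {a b} → a ≡ false → a ∧ b ≡ false
∧-zero refl = refl

∨-introˡ : ∀ {a b} → a ≡ true → a ∨ b ≡ true
∨-introˡ refl = refl

∨-introʳ : ∀ a {b} → b ≡ true → a ∨ b ≡ true
∨-introʳ true  e = refl
∨-introʳ false e = e

true≢false : ∀ {b} → b ≡ true → b ≡ false → ⊥
true≢false refl ()

not-false : ∀ {b} → not b ≡ true → b ≡ false
not-false {false} _ = refl

does⇒ : ∀ {P : Set} (P? : Dec P) → does P? ≡ true → P
does⇒ (yes p) _ = p

ι-mono : ∀ {a b} → (a ≡ true → b ≡ true) → ι a ≤ ι b
ι-mono {false}        h = z≤n
ι-mono {true} {true}  h = ≤-refl
ι-mono {true} {false} h with () ← h refl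

ι≤1 : ∀ b → ι b ≤ 1
ι≤1 true  = ≤-refl
ι≤1 false = z≤n

sum-mono : {f g : Fin n → ℕ} → (∀ i → f i ≤ g i) → Σℕ f ≤ Σℕ g
sum-mono {zero}  h = z≤n
sum-mono {suc n} h = +-mono-≤ (h zero) (sum-mono (h ∘ suc))

sum-+ : (f g : Fin n → ℕ) → Σℕ (λ i → f i + g i) ≡ Σℕ f + Σℕ g
sum-+ = ∑-distrib-+ +-0-commutativeMonoid

sum-zero : (f : Fin n → ℕ) → (∀ i → f i ≡ 0) → Σℕ f ≡ 0
sum-zero {n} f h = trans (sum-cong-≗ +-0-commutativeMonoid h) (sum-replicate-zero +-0-commutativeMonoid n)

term≤sum : (f : Fin n → ℕ) (j : Fin n) → f j ≤ Σℕ f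
term≤sum f zero    = m≤m+n _ _
term≤sum f (suc j) = ≤-trans (term≤sum (f ∘ suc) j) (m≤n+m _ _)

-- The slacks `x` and `y` are charged to the single index `j`. This form accounts for one arc
-- removed or added and for one token moved.
sum-replace : {f g : Fin n → ℕ} (j : Fin n) {x y : ℕ} → (∀ i → i ≢ j → f i ≤ g i) →
              f j + x ≤ g j + y → Σℕ f + x ≤ Σℕ g + y
sum-replace {f = f} {g} zero {x} {y} h e = begin
  f zero + F + x   ≡⟨ exchange (f zero) F x ⟩
  f zero + x + F   ≤⟨ +-mono-≤ e (sum-mono λ i → h (suc i) λ ()) ⟩
  g zero + y + G   ≡⟨ exchange (g zero) y G ⟩
  g zero + G + y   ∎
  where
  open ≤-Reasoning
  F = Σℕ (f ∘ suc)
  G = Σℕ (g ∘ suc)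
  exchange : ∀ p q r → p + q + r ≡ p + r + q
  exchange p q r = trans (+-assoc p q r) (trans (cong (p +_) (+-comm q r)) (sym (+-assoc p r q)))
sum-replace {f = f} {g} (suc j) {x} {y} h e = subst₂ _≤_
  (sym (+-assoc (f zero) _ x)) (sym (+-assoc (g zero) _ y))
  (+-mono-≤ (h zero λ ()) (sum-replace j (λ i i≢j → h (suc i) (i≢j ∘ suc-injective)) e))

Σ₂-mono : {f g : Fin m → Fin n → ℕ} → (∀ a b → f a b ≤ g a b) → Σ₂ f ≤ Σ₂ g
Σ₂-mono h = sum-mono λ a → sum-mono (h a)

Σ₂-+ : (f g : Fin m → Fin n → ℕ) → Σ₂ (λ a b → f a b + g a b) ≡ Σ₂ f + Σ₂ g
Σ₂-+ f g = trans (sum-cong-≗ +-0-commutativeMonoid λ a → sum-+ (f a) (g a)) (sum-+ (Σℕ ∘ f) (Σℕ ∘ g))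

Σ₂-mono-+ : {f g p q : Fin m → Fin n → ℕ} → (∀ a b → f a b + g a b ≤ p a b + q a b) →
            Σ₂ f + Σ₂ g ≤ Σ₂ p + Σ₂ q
Σ₂-mono-+ {f = f} {g} {p} {q} h = subst₂ _≤_ (Σ₂-+ f g) (Σ₂-+ p q) (Σ₂-mono h)

Σ₂-replace : {f g : Fin m → Fin n → ℕ} (u : Fin m) (y : Fin n) {x z : ℕ} →
             (∀ a b → ¬ (a ≡ u × b ≡ y) → f a b ≤ g a b) →
             f u y + x ≤ g u y + z → Σ₂ f + x ≤ Σ₂ g + z
Σ₂-replace u y h e = sum-replace u
  (λ a a≢u → sum-mono λ b → h a b (a≢u ∘ proj₁))
  (sum-replace y (λ b b≢y → h u b (b≢y ∘ proj₂)) e)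

term≤Σ₂ : (f : Fin m → Fin n → ℕ) (a : Fin m) (b : Fin n) → f a b ≤ Σ₂ f
term≤Σ₂ f a b = ≤-trans (term≤sum (f a) b) (term≤sum (Σℕ ∘ f) a)

count-mono : {P Q : VSet n} → (∀ v → P v ≡ true → Q v ≡ true) → count P ≤ count Q
count-mono h = sum-mono λ v → ι-mono (h v)

count-cong : {P Q : VSet n} → P ≗ Q → count P ≡ count Q
count-cong h = sum-cong-≗ +-0-commutativeMonoid λ v → cong ι (h v)

count-∪ : {P Q R : VSet n} → (∀ v → R v ≡ true → P v ≡ true ⊎ Q v ≡ true) →
          count R ≤ count P + count Q
count-∪ {P = P} {Q} {R} h = subst (count R ≤_) (sum-+ (ι ∘ P) (ι ∘ Q)) (sum-mono λ v → le (P v) (Q v) (R v) (h v))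
  where
  le : ∀ p q r → (r ≡ true → p ≡ true ⊎ q ≡ true) → ι r ≤ ι p + ι q
  le p q false h = z≤n
  le p q true h with h refl
  ... | inj₁ refl = s≤s z≤n
  ... | inj₂ refl = m≤n+m 1 (ι p)

count-< : {P Q : VSet n} (x : Fin n) → (∀ v → P v ≡ true → Q v ≡ true) →
          P x ≡ false → Q x ≡ true → count P < count Q
count-< {P = P} {Q} x h px qx = subst₂ _≤_ (+-comm (count P) 1) (+-identityʳ (count Q))
  (sum-replace x (λ i _ → ι-mono (h i)) (subst₂ (λ p q → ι p + 1 ≤ ι q + 0) (sym px) (sym qx) ≤-refl))

count-≤-size : (P : VSet n) → count P ≤ n
count-≤-size {zero}  P = z≤n
count-≤-size {suc n} P = +-mono-≤ (ι≤1 (P zero)) (count-≤-size (P ∘ suc))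

edges-cong : (D : Arcs n) {S S′ R R′ : VSet n} → S ≗ S′ → R ≗ R′ → edges D S R ≡ edges D S′ R′
edges-cong D hS hR = sum-cong-≗ +-0-commutativeMonoid λ a → sum-cong-≗ +-0-commutativeMonoid λ b →
  cong₂ (λ s r → ι (s ∧ D a b ∧ r)) (hS a) (hR b)

cut-cong : (D : Arcs n) {S S′ : VSet n} → S ≗ S′ → cut D S ≡ cut D S′
cut-cong D h = edges-cong D h (cong not ∘ h)

edges-mono : (D E : Arcs n) (S S′ R R′ : VSet n) →
  (∀ a b → S a ≡ true → D a b ≡ true → R b ≡ true → S′ a ∧ E a b ∧ R′ b ≡ true) →
  edges D S R ≤ edges E S′ R′
edges-mono D E S S′ R R′ h = Σ₂-mono λ a b → ι-mono λ e →
  let sa , e′ = ∧-elim (S a) e ; d , r = ∧-elim (D a b) e′ in h a b sa d r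

-- The inequality already holds for the contribution of each arc, which depends only on how its two
-- ends lie in `S` and `R`.
cut-submodular : (D : Arcs n) (S R : VSet n) →
  cut D (λ v → S v ∧ R v) + cut D (λ v → S v ∨ R v) ≤ cut D S + cut D R
cut-submodular D S R = Σ₂-mono-+ λ a b → ≤ᵇ⇒≤ _ _ (taut 5 (λ s s′ r r′ d →
  ι ((s ∧ r) ∧ d ∧ not (s′ ∧ r′)) + ι ((s ∨ r) ∧ d ∧ not (s′ ∨ r′))
    ≤ᵇ ι (s ∧ d ∧ not s′) + ι (r ∧ d ∧ not r′)) tt (S a) (S b) (R a) (R b) (D a b))

cut-complement : (D : Arcs n) → (∀ a b → D a b ≡ D b a) → (S : VSet n) →
  cut D (not ∘ S) ≡ cut D S
cut-complement D D-sym S = trans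
  (∑-comm +-0-commutativeMonoid λ a b → ι (not (S a) ∧ D a b ∧ not (not (S b))))
  (sum-cong-≗ +-0-commutativeMonoid λ b → sum-cong-≗ +-0-commutativeMonoid λ a →
    trans (cong (λ d → ι (not (S a) ∧ d ∧ not (not (S b)))) (D-sym a b))
          (cong ι (reorder (S b) (D b a) (S a))))
  where
  reorder : ∀ s d r → not r ∧ d ∧ not (not s) ≡ s ∧ d ∧ not r
  reorder true  true  true  = refl
  reorder true  true  false = refl
  reorder true  false true  = refl
  reorder true  false false = refl
  reorder false true  true  = refl
  reorder false true  false = refl
  reorder false false true  = refl
  reorder false false false = refl

-- This is submodularity for `S` and the complement of `R`; by symmetry, complementing a set does
-- not change its cut.
cut-posimodular : (D : Arcs n) → (∀ a b → D a b ≡ D b a) → (S R : VSet n) →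
  cut D (λ v → S v ∧ not (R v)) + cut D (λ v → R v ∧ not (S v)) ≤ cut D S + cut D R
cut-posimodular D D-sym S R = subst₂ _≤_
  (cong (cut D (λ v → S v ∧ not (R v)) +_)
    (trans (sym (cut-complement D D-sym (λ v → S v ∨ not (R v)))) (cut-cong D λ v → de-morgan (S v) (R v))))
  (cong (cut D S +_) (cut-complement D D-sym R))
  (cut-submodular D S (not ∘ R))
  where
  de-morgan : ∀ s r → not (s ∨ not r) ≡ r ∧ not s
  de-morgan true  true  = refl
  de-morgan true  false = refl
  de-morgan false true  = refl
  de-morgan false false = refl

-- Vectors of Booleans can be searched exhaustively. Sets are functions here, so the search carries
-- over to properties invariant under pointwise equality.
someSet? : {P : VSet n → Set} → (∀ {S S′} → S ≗ S′ → P S → P S′) →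
           (∀ S → Dec (P S)) → Dec (∃ P)
someSet? {P = P} resp P? = map′ (λ (s , p) → lookup s , p)
  (λ (S , p) → tabulate S , resp (λ v → sym (lookup∘tabulate S v)) p)
  (anySubset? (P? ∘ lookup))

-- Token routing in digraphs

-- The token i placed at p i has to be routed to v, with no arc used by two tokens; by Menger's
-- theorem (see routing) the condition below is sufficient.
CutCondition : Fin n → Arcs n → (Fin N → Fin n) → Set
CutCondition v D p = ∀ S → S v ≡ false → count (S ∘ p) ≤ cut D S

remove : Arcs n → Fin n → Fin n → Arcs n
remove D u y a b = D a b ∧ not (does (a ≟ u) ∧ does (b ≟ y))

move : (Fin N → Fin n) → Fin N → Fin n → Fin N → Fin n
move p i y = updateAt p i (const y)

_⊑_ : Arcs n → Arcs n → Set
E ⊑ D = ∀ a b → E a b ≡ true → D a b ≡ true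

module _ (D : Arcs n) (u y : Fin n) where

  remove-⊑ : remove D u y ⊑ D
  remove-⊑ a b e = proj₁ (∧-elim (D a b) e)

  remove-deleted : remove D u y u y ≡ false
  remove-deleted rewrite dec-true (u ≟ u) refl | dec-true (y ≟ y) refl with D u y
  ... | true  = refl
  ... | false = refl

  remove-other : ∀ a b → ¬ (a ≡ u × b ≡ y) → remove D u y a b ≡ D a b
  remove-other a b ne with a ≟ u | b ≟ y
  ... | yes p | yes q = contradiction (p , q) ne
  ... | yes p | no _  = ∧-identityʳ (D a b)
  ... | no _  | _     = ∧-identityʳ (D a b)

  cut-remove : ∀ S → cut D S ≤ cut (remove D u y) S + ι (S u ∧ not (S y))
  cut-remove S = subst (_≤ cut (remove D u y) S + ι (S u ∧ not (S y))) (+-identityʳ _) (Σ₂-replace u y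
    (λ a b ne → ≤-reflexive (cong (λ d → ι (S a ∧ d ∧ not (S b))) (sym (remove-other a b ne))))
    (≤ᵇ⇒≤ _ _ (taut 4 (λ s t d e → ι (s ∧ d ∧ not t) + 0 ≤ᵇ ι (s ∧ e ∧ not t) + ι (s ∧ not t)) tt
      (S u) (S y) (D u y) (remove D u y u y))))

cut-⊑ : {E D : Arcs n} → E ⊑ D → ∀ S → cut E S ≤ cut D S
cut-⊑ {E = E} {D} h S = edges-mono E D S S (not ∘ S) (not ∘ S) λ a b s e r →
  ∧-intro s (∧-intro (h a b e) r)

cut-add : {E D : Arcs n} (u y : Fin n) → E ⊑ D → E u y ≡ false → D u y ≡ true →
          ∀ S → cut E S + ι (S u ∧ not (S y)) ≤ cut D S
cut-add {E = E} {D} u y h e d S = subst (cut E S + ι (S u ∧ not (S y)) ≤_) (+-identityʳ _) (Σ₂-replace u y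
  (λ a b _ → ι-mono λ q → let s , q′ = ∧-elim (S a) q ; x , r = ∧-elim (E a b) q′ in
    ∧-intro s (∧-intro (h a b x) r))
  (subst₂ (λ e d → ι (S u ∧ e ∧ not (S y)) + ι (S u ∧ not (S y)) ≤ ι (S u ∧ d ∧ not (S y)) + 0) (sym e) (sym d)
    (≤ᵇ⇒≤ _ _ (taut 2 (λ s t → ι (s ∧ false ∧ not t) + ι (s ∧ not t) ≤ᵇ ι (s ∧ true ∧ not t) + 0) tt (S u) (S y)))))

arcCount : Arcs n → ℕ
arcCount D = Σ₂ λ a b → ι (D a b)

arcCount-remove : (D : Arcs n) (u y : Fin n) → D u y ≡ true → arcCount (remove D u y) < arcCount D
arcCount-remove D u y d = subst₂ _≤_ (+-comm (arcCount (remove D u y)) 1) (+-identityʳ (arcCount D))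
  (Σ₂-replace u y (λ a b _ → ι-mono (remove-⊑ D u y a b))
    (subst₂ (λ e d → ι e + 1 ≤ ι d + 0) (sym (remove-deleted D u y)) (sym d) ≤-refl))

module _ (p : Fin N → Fin n) (i : Fin N) (y : Fin n) where

  move-here : move p i y i ≡ y
  move-here = updateAt-updates i p

  move-there : ∀ j → j ≢ i → move p i y j ≡ p j
  move-there j j≢i = updateAt-minimal j i p j≢i

  count-move-≤ : ∀ (S : VSet n) → count (S ∘ move p i y) + ι (S (p i)) ≤ count (S ∘ p) + ι (S y)
  count-move-≤ S = sum-replace i (λ j j≢i → ≤-reflexive (cong (ι ∘ S) (move-there j j≢i)))
    (≤-reflexive (trans (cong (λ w → ι (S w) + ι (S (p i))) move-here) (+-comm (ι (S y)) _)))

  count-move-≥ : ∀ (S : VSet n) → count (S ∘ p) + ι (S y) ≤ count (S ∘ move p i y) + ι (S (p i))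
  count-move-≥ S = sum-replace i (λ j j≢i → ≤-reflexive (cong (ι ∘ S) (sym (move-there j j≢i))))
    (≤-reflexive (trans (+-comm (ι (S (p i))) _) (cong (λ w → ι (S w) + ι (S (p i))) (sym move-here))))

count-modular : (p : Fin N → Fin n) (S R : VSet n) →
  count (S ∘ p) + count (R ∘ p) ≤ count ((λ v → S v ∧ R v) ∘ p) + count ((λ v → S v ∨ R v) ∘ p)
count-modular p S R = subst₂ _≤_ (sum-+ (ι ∘ S ∘ p) _) (sum-+ (λ i → ι (S (p i) ∧ R (p i))) _)
  (sum-mono λ i → ≤ᵇ⇒≤ _ _ (taut 2 (λ s r → ι s + ι r ≤ᵇ ι (s ∧ r) + ι (s ∨ r)) tt (S (p i)) (R (p i))))

module _ {v : Fin n} {D : Arcs n} {p : Fin N → Fin n} (cc : CutCondition v D p) (i : Fin N) where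

  -- Only a set that contains `y` but not the token gains a token without losing an outgoing arc, so
  -- only there is strict slack needed. If the set contains the token but not `y`, it loses one
  -- token and at most one arc.
  move-cut : ∀ y → (∀ S → S v ≡ false → S (p i) ≡ false → S y ≡ true → count (S ∘ p) < cut D S) →
             CutCondition v (remove D (p i) y) (move p i y)
  move-cut y loose S sv with S (p i) in su | S y in sy
                           | count-move-≤ p i y S | cut-remove D (p i) y S
  ... | true  | true  | c | d rewrite +-identityʳ (cut (remove D (p i) y) S) =
    ≤-trans (+-cancelʳ-≤ 1 _ _ c) (≤-trans (cc S sv) d)
  ... | true  | false | c | d rewrite +-identityʳ (count (S ∘ p)) =
    +-cancelʳ-≤ 1 _ _ (≤-trans c (≤-trans (cc S sv) d))
  ... | false | false | c | d
    rewrite +-identityʳ (count (S ∘ p)) | +-identityʳ (count (S ∘ move p i y))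
          | +-identityʳ (cut (remove D (p i) y) S) = ≤-trans c (≤-trans (cc S sv) d)
  ... | false | true  | c | d
    rewrite +-identityʳ (count (S ∘ move p i y))
          | +-identityʳ (cut (remove D (p i) y) S) | +-comm (count (S ∘ p)) 1 =
    ≤-trans c (≤-trans (loose S sv su sy) d)

  -- Equality in the cut condition; the other inequality is `cc`. A tight set containing `y` is
  -- exactly an obstacle to stepping to `y`.
  Tight : VSet n → Set
  Tight S = S v ≡ false × S (p i) ≡ false × cut D S ≤ count (S ∘ p)

  Blocked : Fin n → Set
  Blocked y = ∃ λ S → Tight S × S y ≡ true

  blocked? : ∀ y → Dec (Blocked y)
  blocked? y = someSet?
    (λ h ((a , b , c) , d) → (trans (sym (h v)) a , trans (sym (h (p i))) b ,
      subst₂ _≤_ (cut-cong D h) (count-cong (h ∘ p)) c) , trans (sym (h y)) d)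
    (λ S → ((S v ≟ᵇ false) ×-dec (S (p i) ≟ᵇ false) ×-dec (cut D S ≤ⁿ? count (S ∘ p))) ×-dec (S y ≟ᵇ true))

  -- The cut is submodular and the token count modular, so the slack of the union is at most the sum
  -- of the slacks of `S` and `R` minus that of the intersection, which is nonnegative by the cut
  -- condition.
  tight-∪ : ∀ {S R} → Tight S → Tight R → Tight (λ w → S w ∨ R w)
  tight-∪ {S} {R} (sv , su , st) (rv , ru , rt) = or sv rv , or su ru ,
    +-cancelˡ-≤ (count ((λ w → S w ∧ R w) ∘ p)) _ _ (begin
      count (S∩R ∘ p) + cut D S∪R     ≤⟨ +-monoˡ-≤ _ (cc S∩R (and sv)) ⟩
      cut D S∩R + cut D S∪R           ≤⟨ cut-submodular D S R ⟩
      cut D S + cut D R               ≤⟨ +-mono-≤ st rt ⟩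
      count (S ∘ p) + count (R ∘ p)   ≤⟨ count-modular p S R ⟩
      count (S∩R ∘ p) + count (S∪R ∘ p) ∎)
    where
    open ≤-Reasoning
    S∩R S∪R : VSet n
    S∩R w = S w ∧ R w
    S∪R w = S w ∨ R w
    or : ∀ {a b} → a ≡ false → b ≡ false → a ∨ b ≡ false
    or refl refl = refl
    and : ∀ {a b} → a ≡ false → a ∧ b ≡ false
    and refl = refl

  -- Starting from the empty set, which is tight, the blocking sets of the out-neighbours met so far
  -- are merged into one tight set.
  unblocked-or-tight : ∀ ys → (∃ λ y → D (p i) y ≡ true × ¬ Blocked y) ⊎
    (∃ λ S → Tight S × ∀ y → y ∈ ys → D (p i) y ≡ true → S y ≡ true)
  unblocked-or-tight [] = inj₂ (const false , (refl , refl , ≤-reflexive cut-∅) , λ _ ())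
    where
    cut-∅ : cut D (const false) ≡ count (const false ∘ p)
    cut-∅ = trans (sum-zero {n} _ λ a → sum-zero {n} _ λ b → refl) (sym (sum-zero {N} _ λ _ → refl))
  unblocked-or-tight (y ∷ ys) with unblocked-or-tight ys
  ... | inj₁ r = inj₁ r
  ... | inj₂ (S , S-tight , h) with D (p i) y in d
  ...   | false = inj₂ (S , S-tight , λ
            { _ (here refl) e → ⊥-elim (true≢false e d) ; z (there z∈) e → h z z∈ e })
  ...   | true with blocked? y
  ...     | no ¬b = inj₁ (y , d , ¬b)
  ...     | yes (R , R-tight , ry) = inj₂ ((λ w → R w ∨ S w) , tight-∪ R-tight S-tight , λ
              { _ (here refl) e → ∨-introˡ ry ; z (there z∈) e → ∨-introʳ (R z) (h z z∈ e) })

  -- If every arc out of the token's vertex u were blocked, the union T of the blocking tight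
  -- sets would be tight and absorb all arcs out of u, so T ∪ {u} would violate the condition.
  move-exists : p i ≢ v → ∃ λ y → D (p i) y ≡ true × CutCondition v (remove D (p i) y) (move p i y)
  move-exists u≢v with unblocked-or-tight (allFin n)
  ... | inj₁ (y , d , ¬b) = y , d , move-cut y λ S sv su sy → ≰⇒> λ le → ¬b (S , (sv , su , le) , sy)
  ... | inj₂ (S , (sv , su , st) , h) = ⊥-elim (<-irrefl refl (begin-strict
      cut D S         ≤⟨ st ⟩
      count (S ∘ p)   <⟨ count-< i (λ j → ∨-introˡ {S (p j)}) su Su∋u ⟩
      count (Su ∘ p)  ≤⟨ cc Su Su∌v ⟩
      cut D Su        ≤⟨ edges-mono D D Su S (not ∘ Su) (not ∘ S) shrink ⟩
      cut D S         ∎))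
    where
    open ≤-Reasoning
    Su : VSet n
    Su w = S w ∨ does (w ≟ p i)
    Su∋u : Su (p i) ≡ true
    Su∋u = ∨-introʳ (S (p i)) (dec-true (p i ≟ p i) refl)
    Su∌v : Su v ≡ false
    Su∌v rewrite sv = dec-false (v ≟ p i) (u≢v ∘ sym)
    ∉Su : ∀ b → not (Su b) ≡ true → not (S b) ≡ true
    ∉Su b e with false ← S b = refl
    shrink : ∀ a b → Su a ≡ true → D a b ≡ true → not (Su b) ≡ true → S a ∧ D a b ∧ not (S b) ≡ true
    shrink a b sa d sb with ∨-elim (S a) sa
    ... | inj₁ s = ∧-intro s (∧-intro d (∉Su b sb))
    ... | inj₂ e with refl ← does⇒ (a ≟ p i) e =
      ⊥-elim (true≢false (h b (∈-allFin b) d) (not-false (∉Su b sb)))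

singleton : Fin n → VSet n
singleton u w = does (w ≟ u)

count-singleton : (u : Fin n) → count (singleton u) ≤ 1
count-singleton {n} u = subst₂ _≤_ (+-identityʳ _) (cong (_+ 1) (sum-zero {n} (const 0) λ _ → refl))
  (sum-replace {g = const 0} u (λ i i≢u → ≤-reflexive (cong ι (dec-false (i ≟ u) i≢u))) (+-monoˡ-≤ 0 (ι≤1 _)))

-- The number of tokens still to be routed, which is the budget for the size of `R` in
-- `thin-routing`.
away : Fin n → (Fin N → Fin n) → ℕ
away v p = count λ i → not (does (p i ≟ v))

-- Among the in-neighbours of `v`, only those in `R` may be entered. Arcs into `v` itself survive
-- when `v` has no loop.
avoid : Arcs n → Fin n → VSet n → Arcs n
avoid D v R a b = D a b ∧ (R b ∨ not (D b v))

-- A token standing next to v may always step to v, so when it steps elsewhere its arc to v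
-- has already been used; hence the routing touches at most one in-neighbour of v per token.
thin-routing : ∀ m {v : Fin n} {D : Arcs n} {p : Fin N → Fin n} → arcCount D < m → D v v ≡ false →
  CutCondition v D p → ∃ λ R → count R ≤ away v p ×
    (∀ i → p i ≢ v → D (p i) v ≡ true → R (p i) ≡ true) × CutCondition v (avoid D v R) p
thin-routing {n} {N} (suc m) {v} {D} {p} (s≤s size) loop cc with any? (λ i → ¬? (p i ≟ v))
... | no all-home = const false , ≤-trans (≤-reflexive (sum-zero {n} _ λ _ → refl)) z≤n
    , (λ i ne _ → ⊥-elim (all-home (i , ne)))
    , λ S sv → ≤-trans (≤-reflexive (sum-zero {N} _ λ i → cong ι (trans (cong S (home i)) sv))) z≤n
  where
  home : ∀ i → p i ≡ v
  home i with p i ≟ v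
  ... | yes e = e
  ... | no ne = ⊥-elim (all-home (i , ne))
... | yes (i , u≢v) with D (p i) v in uv
...   | true = R , R-small , R-tokens , R-cut
  where
  D′ = remove D (p i) v
  p′ = move p i v
  ih = thin-routing m {v} {D′} {p′} (≤-trans (arcCount-remove D (p i) v uv) size) (∧-zero loop)
         (move-cut cc i v λ S sv _ sv′ → ⊥-elim (true≢false sv′ sv))
  R′ = proj₁ ih
  R : VSet n
  R w = R′ w ∨ singleton (p i) w
  -- Sending the token home lowers `away` by one, which pays for `p i` joining `R`.
  R-small : count R ≤ away v p
  R-small = begin
    count R                             ≤⟨ count-∪ (λ w → ∨-elim (R′ w)) ⟩
    count R′ + count (singleton (p i))  ≤⟨ +-mono-≤ (proj₁ (proj₂ ih)) (count-singleton (p i)) ⟩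
    away v p′ + 1                       ≤⟨ subst₂ (λ a b → away v p′ + ι (not a) ≤ away v p + ι (not b))
                                             (dec-false (p i ≟ v) u≢v) (dec-true (v ≟ v) refl)
                                             (count-move-≤ p i v (λ w → not (does (w ≟ v)))) ⟩
    away v p + 0                        ≡⟨ +-identityʳ _ ⟩
    away v p                            ∎
    where open ≤-Reasoning
  R-arcs : ∀ w → w ≢ p i → D w v ≡ D′ w v
  R-arcs w ne = sym (remove-other D (p i) v w v (ne ∘ proj₁))
  R-tokens : ∀ j → p j ≢ v → D (p j) v ≡ true → R (p j) ≡ true
  R-tokens j pj≢v e with p j ≟ p i
  ... | yes q = ∨-introʳ (R′ (p j)) refl
  ... | no ne = ∨-introˡ (subst (λ w → R′ w ≡ true) same
        (proj₁ (proj₂ (proj₂ ih)) j (subst (_≢ v) (sym same) pj≢v)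
          (subst (λ w → D′ w v ≡ true) (sym same) (trans (sym (R-arcs (p j) ne)) e))))
    where
    same : p′ j ≡ p j
    same = move-there p i v j λ { refl → ne refl }
  -- In `D′` the vertex `p i` is no longer an in-neighbour of `v`, so arcs into it are not filtered
  -- there; in `D` they survive because `p i` is in `R`.
  R-⊑ : avoid D′ v R′ ⊑ avoid D v R
  R-⊑ a b e with d , r ← ∧-elim (D′ a b) e = ∧-intro (remove-⊑ D (p i) v a b d) (keep r)
    where
    keep : R′ b ∨ not (D′ b v) ≡ true → R b ∨ not (D b v) ≡ true
    keep r with ∨-elim (R′ b) r
    ... | inj₁ r′ = ∨-introˡ (∨-introˡ r′)
    ... | inj₂ d′ = keep′ (b ≟ p i)
      where
      keep′ : Dec (b ≡ p i) → R b ∨ not (D b v) ≡ true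
      keep′ (yes e) = ∨-introˡ (∨-introʳ (R′ b) (dec-true (b ≟ p i) e))
      keep′ (no ne) = ∨-introʳ (R b) (subst (λ d → not d ≡ true) (sym (R-arcs b ne)) d′)
  R-cut : CutCondition v (avoid D v R) p
  R-cut S sv = begin
    count (S ∘ p)                                        ≡⟨ trans (sym (+-identityʳ _)) (cong (λ s → count (S ∘ p) + ι s) (sym sv)) ⟩
    count (S ∘ p) + ι (S v)                              ≤⟨ count-move-≥ p i v S ⟩
    count (S ∘ p′) + ι (S (p i))                         ≤⟨ +-mono-≤ (proj₂ (proj₂ (proj₂ ih)) S sv)
                                                              (ι-mono λ s → ∧-intro s (cong not sv)) ⟩
    cut (avoid D′ v R′) S + ι (S (p i) ∧ not (S v))      ≤⟨ cut-add (p i) v R-⊑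
                                                              (∧-zero (remove-deleted D (p i) v))
                                                              (∧-intro uv (∨-introʳ (R v) (cong not loop))) S ⟩
    cut (avoid D v R) S                                  ∎
    where open ≤-Reasoning
...   | false with y , uy , cc′ ← move-exists cc i u≢v = R , R-small , R-tokens , R-cut
  where
  u = p i
  D′ = remove D u y
  p′ = move p i y
  y≢v : y ≢ v
  y≢v refl = true≢false uy uv
  to-v : ∀ w → D′ w v ≡ D w v
  to-v w = remove-other D u y w v (y≢v ∘ sym ∘ proj₂)
  ih = thin-routing m {v} {D′} {p′} (≤-trans (arcCount-remove D u y uy) size) (trans (to-v v) loop) cc′
  R = proj₁ ih
  R-small : count R ≤ away v p
  R-small = ≤-trans (proj₁ (proj₂ ih)) (+-cancelʳ-≤ 1 _ _
    (subst₂ (λ a b → away v p′ + ι (not a) ≤ away v p + ι (not b))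
      (dec-false (p i ≟ v) u≢v) (dec-false (y ≟ v) y≢v) (count-move-≤ p i y (λ w → not (does (w ≟ v))))))
  R-tokens : ∀ j → p j ≢ v → D (p j) v ≡ true → R (p j) ≡ true
  R-tokens j pj≢v e = subst (λ w → R w ≡ true) same
    (proj₁ (proj₂ (proj₂ ih)) j (subst (_≢ v) (sym same) pj≢v)
      (subst (λ w → D′ w v ≡ true) (sym same) (trans (to-v (p j)) e)))
    where
    same : p′ j ≡ p j
    same = move-there p i y j λ { refl → true≢false e uv }
  -- If `y` is an in-neighbour of `v`, then a token now stands on it and the induction hypothesis
  -- puts `y` into `R`. Hence the arc from `u` to `y` survives `avoid`.
  R-y : D y v ≡ true → R y ≡ true
  R-y e = subst (λ w → R w ≡ true) here-y (proj₁ (proj₂ (proj₂ ih)) i (subst (_≢ v) (sym here-y) y≢v)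
    (subst (λ w → D′ w v ≡ true) (sym here-y) (trans (to-v y) e)))
    where
    here-y : p′ i ≡ y
    here-y = move-here p i y
  R-⊑ : avoid D′ v R ⊑ avoid D v R
  R-⊑ a b e with d , r ← ∧-elim (D′ a b) e =
    ∧-intro (remove-⊑ D u y a b d) (subst (λ d → R b ∨ not d ≡ true) (to-v b) r)
  uy-kept : avoid D v R u y ≡ true
  uy-kept = ∧-intro uy (keep (R y) (D y v) R-y)
    where
    keep : ∀ r d → (d ≡ true → r ≡ true) → r ∨ not d ≡ true
    keep r true  h = ∨-introˡ (h refl)
    keep r false h = ∨-introʳ r refl
  -- Undoing the move exchanges `S y` for `S u` in the token count. The only loss, when `S` contains
  -- `u` but not `y`, is covered by the restored arc.
  R-cut : CutCondition v (avoid D v R) p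
  R-cut S sv = +-cancelʳ-≤ (ι (S y)) _ _ (begin
    count (S ∘ p) + ι (S y)                                    ≤⟨ count-move-≥ p i y S ⟩
    count (S ∘ p′) + ι (S u)                                   ≤⟨ +-mono-≤ (proj₂ (proj₂ (proj₂ ih)) S sv)
                                                                    (≤ᵇ⇒≤ _ _ (taut 2 (λ s t → ι s ≤ᵇ ι (s ∧ not t) + ι t) tt (S u) (S y))) ⟩
    cut (avoid D′ v R) S + (ι (S u ∧ not (S y)) + ι (S y))     ≡⟨ sym (+-assoc (cut (avoid D′ v R) S) _ _) ⟩
    cut (avoid D′ v R) S + ι (S u ∧ not (S y)) + ι (S y)       ≤⟨ +-monoˡ-≤ (ι (S y)) (cut-add u y R-⊑
                                                                    (∧-zero (remove-deleted D u y)) uy-kept S) ⟩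
    cut (avoid D v R) S + ι (S y)                              ∎)
    where open ≤-Reasoning

cutCondition? : (v : Fin n) (D : Arcs n) (p : Fin N → Fin n) →
  (∃ λ S → S v ≡ false × cut D S < count (S ∘ p)) ⊎ CutCondition v D p
cutCondition? v D p with someSet? {P = λ S → S v ≡ false × cut D S < count (S ∘ p)}
  (λ h (a , b) → trans (sym (h v)) a , subst₂ _<_ (cut-cong D h) (count-cong (h ∘ p)) b)
  (λ S → (S v ≟ᵇ false) ×-dec (cut D S <ⁿ? count (S ∘ p)))
... | yes r = inj₁ r
... | no ¬r = inj₂ λ S sv → ≮⇒≥ λ lt → ¬r (S , sv , lt)

-- One removal lowers a cut by at most one, and only if the arc leaves the set; hence a newly
-- violated set was tight and the arc left it.
violated-by-removal : {v : Fin n} {D : Arcs n} {p : Fin N → Fin n} → CutCondition v D p → ∀ a b S →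
  S v ≡ false → cut (remove D a b) S < count (S ∘ p) →
  S a ≡ true × S b ≡ false × cut D S ≤ count (S ∘ p)
violated-by-removal {v = v} {D} {p} cc a b S sv lt with S a | S b | cut-remove D a b S
... | true  | false | c = refl , refl , ≤-trans c (≤-trans (≤-reflexive (+-comm _ 1)) lt)
... | true  | true  | c = ⊥-elim (<-irrefl refl (≤-<-trans (cc S sv) (≤-<-trans c (≤-<-trans (≤-reflexive (+-identityʳ _)) lt))))
... | false | _     | c = ⊥-elim (<-irrefl refl (≤-<-trans (cc S sv) (≤-<-trans c (≤-<-trans (≤-reflexive (+-identityʳ _)) lt))))

-- Sets S and R becoming violated by the removal of ab and of ba are both crossed by the edge ab,
-- which leaves neither S ∩ R nor S ∪ R; submodularity without that edge is then contradictory.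
opposite-arc-removable : {v : Fin n} {D : Arcs n} {p : Fin N → Fin n} → CutCondition v D p → ∀ a b →
  CutCondition v (remove D a b) p ⊎ CutCondition v (remove D b a) p
opposite-arc-removable {n} {v = v} {D} {p} cc a b
  with cutCondition? v (remove D a b) p | cutCondition? v (remove D b a) p
... | inj₂ c | _ = inj₁ c
... | inj₁ _ | inj₂ c = inj₂ c
... | inj₁ (S , sv , s<) | inj₁ (R , rv , r<)
  with sa , sb , _ ← violated-by-removal {p = p} cc a b S sv s< | rb , ra , r≤ ← violated-by-removal {p = p} cc b a R rv r< =
  ⊥-elim (<-irrefl refl (begin-strict
    count (S ∘ p) + count (R ∘ p)       ≤⟨ count-modular p S R ⟩
    count (S∩R ∘ p) + count (S∪R ∘ p)   ≤⟨ +-mono-≤ (cc S∩R (∧-zero sv)) (cc S∪R (subst (λ s → s ∨ R v ≡ false) (sym sv) rv)) ⟩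
    cut D S∩R + cut D S∪R               ≤⟨ +-mono-≤ (uncrossed S∩R (cong₂ (λ s t → (S a ∧ s) ∧ not (t ∧ R b)) ra sb) (taut-∩ (S a)))
                                                    (uncrossed S∪R (cong₂ (λ s t → (s ∨ R a) ∧ not (S b ∨ t)) sa rb) (taut-∪ (S b))) ⟩
    cut D′ S∩R + cut D′ S∪R             ≤⟨ cut-submodular D′ S R ⟩
    -- The strict inequality comes from `S`, which is violated without `ab`; for `R` its tightness
    -- in `D` is enough.
    cut D′ S + cut D′ R                 <⟨ +-mono-<-≤ s< (≤-trans (cut-⊑ (remove-⊑ D a b) R) r≤) ⟩
    count (S ∘ p) + count (R ∘ p)       ∎))
  where
  open ≤-Reasoning
  D′ = remove D a b
  S∩R S∪R : VSet n
  S∩R w = S w ∧ R w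
  S∪R w = S w ∨ R w
  taut-∩ : ∀ s → (s ∧ false) ∧ not false ≡ false
  taut-∩ true  = refl
  taut-∩ false = refl
  taut-∪ : ∀ s → true ∧ not (s ∨ true) ≡ false
  taut-∪ true  = refl
  taut-∪ false = refl
  uncrossed : ∀ X {c} → X a ∧ not (X b) ≡ c → c ≡ false → cut D X ≤ cut D′ X
  uncrossed X e refl = ≤-trans (cut-remove D a b X)
    (≤-reflexive (trans (cong (λ c → cut D′ X + ι c) e) (+-identityʳ _)))

Antisymmetric : Arcs n → Set
Antisymmetric E = ∀ a b → E a b ≡ true → E b a ≡ true → ⊥

-- Arc-disjoint routes may still use an edge of the graph in both directions. Keeping only one arc
-- of each opposite pair turns arc-disjointness into edge-disjointness.
orient : ∀ m {v : Fin n} {D : Arcs n} {p : Fin N → Fin n} → arcCount D < m → CutCondition v D p →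
  ∃ λ E → E ⊑ D × Antisymmetric E × CutCondition v E p
orient (suc m) {v} {D} {p} (s≤s size) cc
  with any? (λ a → any? (λ b → (D a b ≟ᵇ true) ×-dec (D b a ≟ᵇ true)))
... | no none = D , (λ a b e → e) , (λ a b e e′ → none (a , b , e , e′)) , cc
... | yes (a , b , ab , ba) with opposite-arc-removable {p = p} cc a b
...   | inj₁ c with E , h , r ← orient m {p = p} (≤-trans (arcCount-remove D a b ab) size) c =
        E , (λ x y → remove-⊑ D a b x y ∘ h x y) , r
...   | inj₂ c with E , h , r ← orient m {p = p} (≤-trans (arcCount-remove D b a ba) size) c =
        E , (λ x y → remove-⊑ D b a x y ∘ h x y) , r

-- A token owns a set of arcs containing a walk to `v`; paths are extracted later. By `reached`, a
-- vertex that no arc enters can be left only by a token starting there.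
record Routing (v : Fin n) (D : Arcs n) (p : Fin N → Fin n) : Set₁ where
  field
    Uses      : Fin N → Fin n → Fin n → Set
    within    : ∀ {i a b} → Uses i a b → D a b ≡ true
    disjoint  : ∀ {i j a b} → Uses i a b → Uses j a b → i ≡ j
    connected : ∀ i → Star (Uses i) (p i) v
    reached   : ∀ {i a b} → Uses i a b → a ≡ p i ⊎ ∃ λ c → D c a ≡ true

open Routing

-- The sufficiency half of Menger's theorem. While some token is away from `v`, it takes a step
-- preserving the cut condition; the arc is deleted, which gives both termination and disjointness.
routing : ∀ m {v : Fin n} {D : Arcs n} {p : Fin N → Fin n} → arcCount D < m → CutCondition v D p →
  Routing v D p
routing {n} {N} (suc m) {v} {D} {p} (s≤s size) cc with any? (λ i → ¬? (p i ≟ v))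
... | no all-home = record
  { Uses = λ _ _ _ → ⊥ ; within = λ () ; disjoint = λ ()
  ; connected = λ i → subst (λ w → Star _ w v) (sym (home i)) ε ; reached = λ () }
  where
  home : ∀ i → p i ≡ v
  home i with p i ≟ v
  ... | yes e = e
  ... | no ne = ⊥-elim (all-home (i , ne))
... | yes (i , u≢v) with y , uy , cc′ ← move-exists cc i u≢v = record
  { Uses = Uses⁺ ; within = within⁺ ; disjoint = disjoint⁺ ; connected = connected⁺ ; reached = reached⁺ }
  where
  u = p i
  rest : Routing v (remove D u y) (move p i y)
  rest = routing m (≤-trans (arcCount-remove D u y uy) size) cc′
  Uses⁺ : Fin N → Fin n → Fin n → Set
  Uses⁺ j a b = Uses rest j a b ⊎ (j ≡ i × a ≡ u × b ≡ y)
  within⁺ : ∀ {j a b} → Uses⁺ j a b → D a b ≡ true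
  within⁺ (inj₁ r) = remove-⊑ D u y _ _ (within rest r)
  within⁺ (inj₂ (_ , refl , refl)) = uy
  fresh : ∀ {j} → ¬ Uses rest j u y
  fresh r = true≢false (within rest r) (remove-deleted D u y)
  disjoint⁺ : ∀ {j k a b} → Uses⁺ j a b → Uses⁺ k a b → j ≡ k
  disjoint⁺ (inj₁ r) (inj₁ s) = disjoint rest r s
  disjoint⁺ (inj₁ r) (inj₂ (_ , refl , refl)) = ⊥-elim (fresh r)
  disjoint⁺ (inj₂ (_ , refl , refl)) (inj₁ s) = ⊥-elim (fresh s)
  disjoint⁺ (inj₂ (refl , _)) (inj₂ (refl , _)) = refl
  connected⁺ : ∀ j → Star (Uses⁺ j) (p j) v
  connected⁺ j with j ≟ i | Star.map (inj₁ {B = j ≡ i × _ ≡ u × _ ≡ y}) (connected rest j)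
  ... | yes refl | s = inj₂ (refl , refl , refl) ◅ subst (λ w → Star (Uses⁺ j) w v) (move-here p i y) s
  ... | no ne    | s = subst (λ w → Star (Uses⁺ j) w v) (move-there p i y j ne) s
  reached⁺ : ∀ {j a b} → Uses⁺ j a b → a ≡ p j ⊎ ∃ λ c → D c a ≡ true
  reached⁺ (inj₂ (refl , refl , _)) = inj₁ refl
  reached⁺ {j} (inj₁ r) with reached rest r
  ... | inj₂ (c , e) = inj₂ (c , remove-⊑ D u y _ _ e)
  ... | inj₁ e with j ≟ i
  ...   | yes refl = inj₂ (u , subst (λ w → D u w ≡ true) (sym (trans e (move-here p i y))) uy)
  ...   | no ne = inj₁ (trans e (move-there p i y j ne))

-- Strong immersions around a hub

count-full : (P : VSet n) → (∀ v → P v ≡ true) → count P ≡ n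
count-full {zero}  P h = refl
count-full {suc n} P h = cong₂ _+_ (cong ι (h zero)) (count-full (P ∘ suc) (h ∘ suc))

count-empty : (P : VSet n) → (∀ v → P v ≡ false) → count P ≡ 0
count-empty P h = sum-zero _ λ v → cong ι (h v)

-- Double counting: some vertex u of M lies in at most k of the sets R w; discard R u and those w.
independent : ∀ t (M : VSet n) (R : Fin n → VSet n) → (∀ u → M u ≡ true → count (R u) ≤ k) →
  t * suc (k + k) ≤ count M →
  ∃ λ (b : Fin t → Fin n) → (∀ i → M (b i) ≡ true) × (∀ i j → i ≢ j → b i ≢ b j × R (b i) (b j) ≡ false)
independent zero M R small size = (λ ()) , (λ ()) , λ ()
independent {n} {k} (suc t) M R small size
  with any? (λ u → (M u ≟ᵇ true) ×-dec (count (λ w → M w ∧ R w u) ≤ⁿ? k))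
... | no none = ⊥-elim (<-irrefl refl (≤-trans (s≤s z≤n) (≤-trans size M-empty)))
  where
  open ≤-Reasoning
  bound : ℕ → Fin n → ℕ
  bound c u = if M u then c else 0
  row : ∀ u → bound (suc k) u ≤ Σℕ λ w → ι (M u ∧ M w ∧ R w u)
  row u with M u in mu
  ... | false = z≤n
  ... | true  = ≰⇒> λ le → none (u , mu , le)
  column : ∀ w → Σℕ (λ u → ι (M u ∧ M w ∧ R w u)) ≤ bound k w
  column w with M w in mw
  ... | false = ≤-reflexive (sum-zero _ λ u → cong ι (∧-zeroʳ (M u)))
  ... | true  = ≤-trans (count-mono λ u e → proj₂ (∧-elim (M u) e)) (small w mw)
  -- Every row sum over `M` is at least `k + 1` and every column sum at most `k`, so double counting
  -- leaves no vertex in `M`, against `size`.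
  M-empty : count M ≤ 0
  M-empty = +-cancelˡ-≤ (Σℕ (bound k)) _ _ (begin
    Σℕ (bound k) + count M                        ≡⟨ sym (sum-+ (bound k) (ι ∘ M)) ⟩
    Σℕ (λ u → bound k u + ι (M u))                ≤⟨ sum-mono (λ u → split (M u)) ⟩
    Σℕ (bound (suc k))                            ≤⟨ sum-mono row ⟩
    Σ₂ (λ u w → ι (M u ∧ M w ∧ R w u))            ≡⟨ ∑-comm +-0-commutativeMonoid (λ u w → ι (M u ∧ M w ∧ R w u)) ⟩
    Σ₂ (λ w u → ι (M u ∧ M w ∧ R w u))            ≤⟨ sum-mono column ⟩
    Σℕ (bound k)                                  ≡⟨ sym (+-identityʳ _) ⟩
    Σℕ (bound k) + 0                              ∎)
    where
    split : ∀ m → (if m then k else 0) + ι m ≤ (if m then suc k else 0)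
    split true  = ≤-reflexive (+-comm k 1)
    split false = z≤n
... | yes (u , mu , u-small) = b , b∈M , b-ind
  where
  M′ : VSet n
  M′ w = M w ∧ not (singleton u w) ∧ not (R u w) ∧ not (R w u)
  discarded : ∀ w → M w ≡ true → M′ w ≡ true ⊎ singleton u w ∨ R u w ∨ (M w ∧ R w u) ≡ true
  discarded w mw = cases (M w) (singleton u w) (R u w) (R w u) mw
    where
    cases : ∀ m s x y → m ≡ true → m ∧ not s ∧ not x ∧ not y ≡ true ⊎ s ∨ x ∨ (m ∧ y) ≡ true
    cases true false false false _ = inj₁ refl
    cases true true  x     y     _ = inj₂ refl
    cases true false true  y     _ = inj₂ refl
    cases true false false true  _ = inj₂ refl
  -- Discarded are `u` itself, at most `k` members of `R u`, and at most `k` vertices `w` with `u`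
  -- in `R w`; this is the constant `suc (k + k)`.
  M′-size : t * suc (k + k) ≤ count M′
  M′-size = +-cancelˡ-≤ (suc (k + k)) _ _ (begin
    suc (k + k) + t * suc (k + k)   ≤⟨ size ⟩
    count M                         ≤⟨ count-∪ discarded ⟩
    count M′ + count (λ w → singleton u w ∨ R u w ∨ (M w ∧ R w u))
      ≤⟨ +-monoʳ-≤ (count M′) (≤-trans (count-∪ {P = singleton u} {λ w → R u w ∨ (M w ∧ R w u)} λ w → ∨-elim (singleton u w))
          (+-mono-≤ (count-singleton u) (≤-trans (count-∪ {P = R u} {λ w → M w ∧ R w u} λ w → ∨-elim (R u w))
            (+-mono-≤ (small u mu) u-small)))) ⟩
    count M′ + suc (k + k)          ≡⟨ +-comm (count M′) _ ⟩
    suc (k + k) + count M′          ∎)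
    where open ≤-Reasoning
  M′⊆M : ∀ w → M′ w ≡ true → M w ≡ true
  M′⊆M w = proj₁ ∘ ∧-elim (M w)
  rest = independent t M′ R (λ w → small w ∘ M′⊆M w) M′-size
  b : Fin (suc t) → Fin n
  b zero    = u
  b (suc i) = proj₁ rest i
  b∈M : ∀ i → M (b i) ≡ true
  b∈M zero    = mu
  b∈M (suc i) = M′⊆M _ (proj₁ (proj₂ rest) i)
  from-M′ : ∀ w → M′ w ≡ true → w ≢ u × R u w ≡ false × R w u ≡ false
  from-M′ w e with _ , e₁ ← ∧-elim (M w) e with s , e₂ ← ∧-elim (not (singleton u w)) e₁
    with x , y ← ∧-elim (not (R u w)) e₂ =
    (λ w≡u → true≢false (dec-true (w ≟ u) w≡u) (not-false s)) , not-false x , not-false y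
  b-ind : ∀ i j → i ≢ j → b i ≢ b j × R (b i) (b j) ≡ false
  b-ind zero    zero    ne = ⊥-elim (ne refl)
  b-ind zero    (suc j) ne with w≢u , x , y ← from-M′ _ (proj₁ (proj₂ rest) j) = w≢u ∘ sym , x
  b-ind (suc i) zero    ne with w≢u , x , y ← from-M′ _ (proj₁ (proj₂ rest) i) = w≢u , y
  b-ind (suc i) (suc j) ne = proj₂ (proj₂ rest) i j (ne ∘ cong suc)

module _ {R : Fin n → Fin n → Set} where

  path-suffix : ∀ {a b} xs → a ∈ xs ++ [ b ] → a ≢ b → Unique (xs ++ [ b ]) → Linked R (xs ++ [ b ]) →
    ∃ λ inner → Unique (a ∷ inner ++ [ b ]) × Linked R (a ∷ inner ++ [ b ])
  path-suffix []       (here refl) a≢b u l = ⊥-elim (a≢b refl)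
  path-suffix (x ∷ xs) (here refl) a≢b u l = xs , u , l
  path-suffix (x ∷ xs) (there a∈)  a≢b u l = path-suffix xs a∈ a≢b (AllPairs.tail u) (Linked.tail l)

  -- Loop erasure: if the start recurs on the path built from the rest of the walk, that path is cut
  -- back to its suffix from there. Distinct ends are needed for the shape of `route`.
  star⇒path : ∀ {a b} → Star R a b → a ≢ b →
    ∃ λ inner → Unique (a ∷ inner ++ [ b ]) × Linked R (a ∷ inner ++ [ b ])
  star⇒path ε a≢b = ⊥-elim (a≢b refl)
  star⇒path {a} {b} (_◅_ {j = c} r s) a≢b with c ≟ b
  ... | yes refl = [] , (a≢b ∷ []) ∷ [] ∷ [] , r ∷ [-]
  ... | no c≢b with inner , u , l ← star⇒path s c≢b with Any.any? (a ≟_) (c ∷ inner ++ [ b ])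
  ...   | yes a∈ = path-suffix (c ∷ inner) a∈ a≢b u l
  ...   | no a∉  = c ∷ inner , ¬Any⇒All¬ _ a∉ ∷ u , r ∷ l

  linked⇒edge : ∀ {xs x y} → Linked R xs → EdgeOf xs x y → R x y ⊎ R y x
  linked⇒edge (r ∷ l) fwd       = inj₁ r
  linked⇒edge (r ∷ l) bwd       = inj₂ r
  linked⇒edge (r ∷ l) (there e) = linked⇒edge l e
  linked⇒edge [-]     (there ())

predecessor : ∀ {A : Set} {a x : A} {xs} → x ∈ xs → ∃ λ y → EdgeOf (a ∷ xs) y x
predecessor (here refl) = _ , fwd
predecessor (there x∈) with y , e ← predecessor x∈ = y , there e

unique⇒≢last : ∀ {A : Set} {b x : A} xs → Unique (xs ++ [ b ]) → x ∈ xs → x ≢ b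
unique⇒≢last (z ∷ xs) (z∉ ∷ u) (here refl) refl = All.lookup z∉ (∈-++⁺ʳ xs (here refl)) refl
unique⇒≢last (z ∷ xs) (z∉ ∷ u) (there x∈)  e    = unique⇒≢last xs u x∈ e

-- `R i` holds the neighbours of `v` that the paths from `branch i` may enter. By `separate` these
-- paths avoid all other branch vertices, since branch vertices are neighbours of `v`.
module Hub (G : Graph) (t : ℕ) (v : Vertex G) (branch : Fin t → Vertex G)
  (distinct : ∀ i j → i ≢ j → branch i ≢ branch j)
  (branch→v : ∀ i → adj G (branch i) v ≡ true)
  (R : Fin t → VSet (size G))
  (separate : ∀ i j → i ≢ j → R i (branch j) ≡ false)
  (flow : ∀ i S → S v ≡ false → S (branch i) ≡ true → t * t ≤ cut (avoid (adj G) v (R i)) S) where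

  private
    V : Set
    V = Vertex G

  isBranch? : ∀ w → Dec (∃ λ i → branch i ≡ w)
  isBranch? w = any? λ i → branch i ≟ w

  -- With no arc entering a branch vertex, no token can pass through one.
  intoNonBranch : Arcs (size G)
  intoNonBranch a b = adj G a b ∧ not (does (isBranch? b))

  -- Token `combine i j` starts at `branch i` and provides the half from `branch i` to `v` of the
  -- link with `branch j`.
  start : Fin (t * t) → V
  start τ = branch (proj₁ (remQuot {t} t τ))

  -- A set containing some `branch i` has at least `t * t` outgoing arcs in the digraph of `R i`, as
  -- many as there are tokens. None of these enters a branch vertex outside the set: such a vertex
  -- is a neighbour of `v` not in `R i`.
  cutCondition : CutCondition v intoNonBranch start
  cutCondition S sv with any? (λ i → S (branch i) ≟ᵇ true)
  ... | no none = ≤-trans (≤-reflexive (count-empty (S ∘ start) λ τ → ¬-not λ e → none (_ , e))) z≤n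
  ... | yes (i , si) = ≤-trans (count-≤-size (S ∘ start)) (≤-trans (flow i S sv si)
        (edges-mono (avoid (adj G) v (R i)) intoNonBranch S S (not ∘ S) (not ∘ S) keep))
    where
    keep : ∀ a b → S a ≡ true → avoid (adj G) v (R i) a b ≡ true → not (S b) ≡ true →
           S a ∧ intoNonBranch a b ∧ not (S b) ≡ true
    keep a b sa e sb with d , r ← ∧-elim (adj G a b) e =
      ∧-intro sa (∧-intro (∧-intro d (cong not (dec-false (isBranch? b) nonBranch))) sb)
      where
      nonBranch : ¬ ∃ λ j → branch j ≡ b
      nonBranch (j , refl) with ∨-elim (R i b) r
      ... | inj₁ x = true≢false x (separate i j λ { refl → true≢false si (not-false sb) })
      ... | inj₂ x = true≢false (branch→v j) (not-false x)

  oriented : ∃ λ E → E ⊑ intoNonBranch × Antisymmetric E × CutCondition v E start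
  oriented = orient (suc (arcCount intoNonBranch)) {p = start} ≤-refl cutCondition

  E : Arcs (size G)
  E = proj₁ oriented

  tokens : Routing v E start
  tokens = routing (suc (arcCount E)) {p = start} ≤-refl (proj₂ (proj₂ (proj₂ oriented)))

  E⇒adj : ∀ {a b} → E a b ≡ true → adj G a b ≡ true
  E⇒adj {a} {b} e = proj₁ (∧-elim (adj G a b) (proj₁ (proj₂ oriented) a b e))

  no-arc-into-branch : ∀ {a} k → E a (branch k) ≡ true → ⊥
  no-arc-into-branch {a} k e = true≢false (dec-true (isBranch? (branch k)) (k , refl))
    (not-false (proj₂ (∧-elim (adj G a (branch k)) (proj₁ (proj₂ oriented) a (branch k) e))))

  UsesEdge : Fin (t * t) → V → V → Set
  UsesEdge τ x y = Uses tokens τ x y ⊎ Uses tokens τ y x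

  -- The two half-links are joined at `v`, the second one traversed backwards, so direction is
  -- forgotten.
  Link : Fin t → Fin t → V → V → Set
  Link i j x y = UsesEdge (combine i j) x y ⊎ UsesEdge (combine j i) x y

  flip-edge : ∀ {τ x y} → UsesEdge τ x y → UsesEdge τ y x
  flip-edge (inj₁ e) = inj₂ e
  flip-edge (inj₂ e) = inj₁ e

  flip-link : ∀ {i j x y} → Link i j x y → Link i j y x
  flip-link (inj₁ e) = inj₁ (flip-edge e)
  flip-link (inj₂ e) = inj₂ (flip-edge e)

  link⇒adj : ∀ {i j x y} → Link i j x y → Adj G x y
  link⇒adj (inj₁ e) = edge⇒adj e
    where
    edge⇒adj : ∀ {τ x y} → UsesEdge τ x y → Adj G x y
    edge⇒adj (inj₁ e) = E⇒adj (within tokens e)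
    edge⇒adj {x = x} {y} (inj₂ e) = trans (Graph.sym G x y) (E⇒adj (within tokens e))
  link⇒adj (inj₂ e) = link⇒adj (inj₁ e)

  start-combine : ∀ i j → start (combine i j) ≡ branch i
  start-combine i j = cong (branch ∘ proj₁) (remQuot-combine i j)

  link-star : ∀ i j → Star (Link i j) (branch i) (branch j)
  link-star i j =
    subst (λ w → Star (Link i j) w v) (start-combine i j) (Star.map (inj₁ ∘ inj₁) (connected tokens (combine i j)))
    ◅◅ Star.reverse flip-link
    (subst (λ w → Star (Link i j) w v) (start-combine j i) (Star.map (inj₂ ∘ inj₁) (connected tokens (combine j i))))

  -- An edge at a branch vertex must be used as an arc leaving it, and by `reached` only the token
  -- that starts there can do so.
  edge-at-branch : ∀ {i j y} k → UsesEdge (combine i j) y (branch k) → branch k ≡ branch i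
  edge-at-branch k (inj₁ e) = ⊥-elim (no-arc-into-branch k (within tokens e))
  edge-at-branch {i} {j} k (inj₂ e) with reached tokens e
  ... | inj₁ q       = trans q (start-combine i j)
  ... | inj₂ (c , d) = ⊥-elim (no-arc-into-branch k d)

  link-at-branch : ∀ {i j y} k → Link i j y (branch k) → branch k ≡ branch i ⊎ branch k ≡ branch j
  link-at-branch k (inj₁ e) = inj₁ (edge-at-branch k e)
  link-at-branch k (inj₂ e) = inj₂ (edge-at-branch k e)

  -- Opposite uses of one edge are excluded by antisymmetry of `E`.
  same-token : ∀ {τ σ x y} → UsesEdge τ x y → UsesEdge σ x y → τ ≡ σ
  same-token (inj₁ e) (inj₁ f) = disjoint tokens e f
  same-token (inj₂ e) (inj₂ f) = disjoint tokens e f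
  same-token (inj₁ e) (inj₂ f) = ⊥-elim (proj₁ (proj₂ (proj₂ oriented)) _ _ (within tokens e) (within tokens f))
  same-token (inj₂ e) (inj₁ f) = ⊥-elim (proj₁ (proj₂ (proj₂ oriented)) _ _ (within tokens e) (within tokens f))

  link-disjoint : ∀ {i j k l x y} → i Fin.< j → k Fin.< l → ¬ (i ≡ k × j ≡ l) →
    Link i j x y → Link k l x y → ⊥
  link-disjoint {i} {j} {k} {l} i<j k<l ne = λ
    { (inj₁ e) (inj₁ f) → ne (combine-injective i j k l (same-token e f))
    ; (inj₁ e) (inj₂ f) → crossed (combine-injective i j l k (same-token e f))
    ; (inj₂ e) (inj₁ f) → crossed (swap (combine-injective j i k l (same-token e f)))
    ; (inj₂ e) (inj₂ f) → ne (swap (combine-injective j i l k (same-token e f)))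
    }
    where
    crossed : i ≡ l × j ≡ k → ⊥
    crossed (refl , refl) = <-asym i<j k<l

  path : ∀ i j → ∃ λ inner → i ≢ j →
    Unique (branch i ∷ inner ++ [ branch j ]) × Linked (Link i j) (branch i ∷ inner ++ [ branch j ])
  path i j with i ≟ j
  -- `inner` has to be total, so the diagonal receives the empty list as a default.
  ... | yes i≡j = [] , λ i≢j → ⊥-elim (i≢j i≡j)
  ... | no i≢j with inner , r ← star⇒path (link-star i j) (distinct i j i≢j) = inner , λ _ → r

  <⇒≢ᶠ : ∀ {i j : Fin t} → i Fin.< j → i ≢ j
  <⇒≢ᶠ i<j refl = <-irrefl refl i<j

  route-edge : ∀ {i j x y} → i Fin.< j → EdgeOf (branch i ∷ proj₁ (path i j) ++ [ branch j ]) x y → Link i j x y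
  route-edge {i} {j} i<j e with linked⇒edge (proj₂ (proj₂ (path i j) (<⇒≢ᶠ i<j))) e
  ... | inj₁ l = l
  ... | inj₂ l = flip-link l

  immersion : StrongImmersionK t G
  immersion = record
    { branch       = branch
    ; injective    = λ {i} {j} e → decidable-stable (i ≟ j) λ ne → distinct i j ne e
    ; inner        = λ i j → proj₁ (path i j)
    ; isPath       = λ i j i<j → let u , l = proj₂ (path i j) (<⇒≢ᶠ i<j) in u , Linked.map link⇒adj l
    ; strong       = strong
    ; edgeDisjoint = λ i j k l i<j k<l ne x y e f → link-disjoint i<j k<l ne (route-edge i<j e) (route-edge k<l f)
    }
    where
    strong : ∀ i j → i Fin.< j → ∀ w → w ∈ proj₁ (path i j) → ∀ k → w ≢ branch k
    -- An internal vertex has an edge of the route before it. If it were a branch vertex,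
    -- `link-at-branch` would make it an end of the route, which a path does not revisit.
    strong i j i<j w w∈ k refl with proj₂ (path i j) (<⇒≢ᶠ i<j) | predecessor w∈
    ... | (w≢ ∷ u) , l | y , e with link-at-branch k (route-edge i<j (extend e))
      where
      extend : ∀ {A : Set} {xs ys : List A} {x y} → EdgeOf xs x y → EdgeOf (xs ++ ys) x y
      extend fwd       = fwd
      extend bwd       = bwd
      extend (there e) = there (extend e)
    ...   | inj₁ q = All.lookup w≢ (∈-++⁺ˡ w∈) (sym q)
    ...   | inj₂ q = unique⇒≢last _ u w∈ q

many-strong-neighbours⇒immersion : (G : Graph) (t : ℕ) (v : Vertex G) (M : VSet (size G)) →
  (∀ u → M u ≡ true → adj G u v ≡ true × (∀ S → S v ≡ false → S u ≡ true → t * t ≤ cut (adj G) S)) →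
  t * suc (t * t + t * t) ≤ count M → StrongImmersionK t G
many-strong-neighbours⇒immersion G t v M strong large =
  Hub.immersion G t v b (λ i j ne → proj₁ (ind i j ne)) (λ i → proj₁ (strong (b i) (b∈M i)))
    (proj₁ ∘ thin ∘ b) (λ i j ne → proj₂ (ind i j ne))
    (λ i → proj₂ (proj₂ (thin (b i)) (b∈M i)))
  where
  -- With all `t * t` tokens on `u`, the cut condition says that no cut of fewer arcs separates `u`
  -- from `v`.
  tokens : Vertex G → Fin (t * t) → Vertex G
  tokens u = const u
  cutCondition : ∀ u → M u ≡ true → CutCondition v (adj G) (tokens u)
  cutCondition u mu S sv with S u in su
  ... | true  = ≤-trans (count-≤-size {t * t} _) (proj₂ (strong u mu) S sv su)
  ... | false = ≤-trans (≤-reflexive (count-empty {t * t} _ λ _ → refl)) z≤n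
  thin : ∀ u → ∃ λ R → M u ≡ true → count R ≤ t * t ×
    (∀ S → S v ≡ false → S u ≡ true → t * t ≤ cut (avoid (adj G) v R) S)
  thin u with M u in mu
  -- `independent` takes a family indexed by all vertices; outside `M` the empty set is a default.
  ... | false = const false , λ ()
  ... | true
    with R , small , _ , cc ← thin-routing (suc (arcCount (adj G))) {p = tokens u} ≤-refl (irrefl G v) (cutCondition u mu) =
        R , λ _ → ≤-trans small (count-≤-size {t * t} _) ,
          λ S sv su → ≤-trans (≤-reflexive (sym (count-full (S ∘ tokens u) λ _ → su))) (cc S sv)
  selection = independent t M (proj₁ ∘ thin) (λ u mu → proj₁ (proj₂ (thin u) mu)) large
  b = proj₁ selection
  b∈M = proj₁ (proj₂ selection)
  ind = proj₂ (proj₂ selection)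

-- Colouring graphs whose edges lie in small cuts

_⊆_ : VSet n → VSet n → Set
S ⊆ Z = ∀ v → S v ≡ true → Z v ≡ true

Disjoint : VSet n → VSet n → Set
Disjoint S R = ∀ v → S v ≡ true → R v ≡ false

-- `S` does not split `C`, so it is still a vertex set after `C` is contracted.
Uniform : VSet n → VSet n → Set
Uniform S C = ∀ a b → C a ≡ true → C b ≡ true → S a ≡ S b

⋃ : List (VSet n) → VSet n
⋃ []       v = false
⋃ (C ∷ cs) v = C v ∨ ⋃ cs v

⋃-elim : ∀ (cs : List (VSet n)) {v} → ⋃ cs v ≡ true → ∃ λ C → C ∈ cs × C v ≡ true
⋃-elim (C ∷ cs) {v} e with ∨-elim (C v) e
... | inj₁ cv = C , here refl , cv
... | inj₂ uv with C′ , C′∈ , cv ← ⋃-elim cs uv = C′ , there C′∈ , cv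

⋃-intro : ∀ {cs : List (VSet n)} {C v} → C ∈ cs → C v ≡ true → ⋃ cs v ≡ true
⋃-intro (here refl) e = ∨-introˡ e
⋃-intro {cs = C ∷ _} {v = v} (there C∈) e = ∨-introʳ (C v) (⋃-intro C∈ e)

⊆-outside : {S Z : VSet n} → S ⊆ Z → ∀ v → Z v ≡ false → S v ≡ false
⊆-outside h v zv = ¬-not λ sv → true≢false (h v sv) zv

least : {P : VSet n → Set} → (∀ {S S′} → S ≗ S′ → P S → P S′) → (∀ S → Dec (P S)) →
  (D : Arcs n) → ∀ m S → P S → cut D S < m →
  ∃ λ A → P A × cut D A ≤ cut D S × (∀ S′ → P S′ → cut D A ≤ cut D S′)
least {P = P} resp P? D (suc m) S ps (s≤s size)
  with someSet? {P = λ R → P R × cut D R < cut D S}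
         (λ h (p , lt) → resp h p , subst (_< cut D S) (cut-cong D h) lt)
         (λ R → P? R ×-dec (cut D R <ⁿ? cut D S))
... | no none = S , ps , ≤-refl , λ R pr → ≮⇒≥ λ lt → none (R , pr , lt)
... | yes (R , pr , lt) with A , pa , le , min ← least resp P? D m R pr (≤-trans lt size) =
  A , pa , ≤-trans le (<⇒≤ lt) , min

module SmallCuts (H : Arcs n) (H-sym : ∀ a b → H a b ≡ H b a) (k : ℕ) where

  -- Neighbours outside `Z` count as same-coloured whatever their colour, so a bound on the defect
  -- survives every colouring of the rest.
  defect : (Fin n → Bool) → VSet n → Fin n → ℕ
  defect φ Z v = count λ u → H v u ∧ (not (Z u) ∨ does (φ u ≟ᵇ φ v))

  -- The colour of the vertices with neighbours outside `Z` can be prescribed. In the bound, `k`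
  -- stands for the edges leaving `Z`, and `k * k` for at most `k` pieces with such an edge, each
  -- containing at most `k` neighbours of a given outside vertex.
  Colourable : VSet n → Set
  Colourable Z = ∀ c → ∃ λ φ →
    (∀ v u → Z v ≡ true → Z u ≡ false → H v u ≡ true → φ v ≡ c) ×
    (∀ v → Z v ≡ true → defect φ Z v ≤ k + k * k)

  Piece : VSet n → Set
  Piece C = cut H C ≤ k × Colourable C

  -- Edges leaving `C` are already charged in full, so passing to a larger set can only lower the
  -- defect.
  defect-mono : ∀ {φ ψ C Z} → C ⊆ Z → (∀ u → C u ≡ true → φ u ≡ ψ u) → ∀ v → C v ≡ true →
    defect φ Z v ≤ defect ψ C v
  defect-mono {φ} {ψ} {C} {Z} C⊆Z agree v cv = count-mono λ u e →
    let h , r = ∧-elim (H v u) e in ∧-intro h (weaken u (∨-elim (not (Z u)) r))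
    where
    weaken : ∀ u → not (Z u) ≡ true ⊎ does (φ u ≟ᵇ φ v) ≡ true → not (C u) ∨ does (ψ u ≟ᵇ ψ v) ≡ true
    weaken u (inj₁ z) = ∨-introˡ (cong not (⊆-outside C⊆Z u (not-false z)))
    weaken u (inj₂ s) with C u in cu
    ... | false = refl
    ... | true  = subst₂ (λ x y → does (x ≟ᵇ y) ≡ true) (agree u cu) (agree v cv) s

  neighbours-in≤cut : ∀ C v → C v ≡ false → count (λ u → C u ∧ H v u) ≤ cut H C
  neighbours-in≤cut C v cv = sum-mono λ u → ≤-trans
    (ι-mono λ e → let c , h = ∧-elim (C u) e in ∧-intro c (∧-intro (trans (H-sym u v) h) (cong not cv)))
    (term≤sum (λ b → ι (C u ∧ H u b ∧ not (C b))) v)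

  neighbours-out≤cut : ∀ Z v → Z v ≡ true → count (λ u → H v u ∧ not (Z u)) ≤ cut H Z
  neighbours-out≤cut Z v zv = ≤-trans
    (sum-mono λ u → ι-mono {H v u ∧ not (Z u)} λ e → ∧-intro zv e)
    (term≤sum (λ a → Σℕ λ b → ι (Z a ∧ H a b ∧ not (Z b))) v)

  edges-⊎ : ∀ {C U} R → Disjoint C U → edges H C R + edges H U R ≤ edges H (λ v → C v ∨ U v) R
  edges-⊎ {C} {U} R disj = subst (_≤ edges H (λ v → C v ∨ U v) R)
    (Σ₂-+ (λ a b → ι (C a ∧ H a b ∧ R b)) _)
    (Σ₂-mono λ a b → le (H a b ∧ R b) (C a) (U a) (disj a))
    where
    le : ∀ r c u → (c ≡ true → u ≡ false) → ι (c ∧ r) + ι (u ∧ r) ≤ ι ((c ∨ u) ∧ r)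
    le r false u     h = ≤-refl
    le r true  false h = ≤-reflexive (+-identityʳ _)
    le r true  true  h with () ← h refl

  edges-zero : ∀ C R → edges H C R ≡ 0 → ∀ a b → C a ≡ true → H a b ≡ true → R b ≡ true → ⊥
  edges-zero C R e a b ca h rb with subst (ι (C a ∧ H a b ∧ R b) ≤_) e (term≤Σ₂ (λ a b → ι (C a ∧ H a b ∧ R b)) a b)
  ... | le rewrite ca | h | rb with () ← le

  OwnDefect : (Fin n → Bool) → VSet n → Set
  OwnDefect φ C = ∀ v → C v ≡ true → defect φ C v ≤ k + k * k

  -- A piece with an edge leaving Z gets boundary colour c, the others get the opposite colour.
  -- Then only pieces of the first kind contribute monochromatic edges to vertices outside all
  -- pieces, and each of these pieces uses up an edge leaving Z.
  colour-pieces : ∀ cs Z c → AllPairs Disjoint cs → All Piece cs → All (_⊆ Z) cs → ∃ λ φ →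
    (∀ v → ⋃ cs v ≡ false → φ v ≡ c) ×
    (∀ v u → ⋃ cs v ≡ true → Z u ≡ false → H v u ≡ true → φ v ≡ c) ×
    All (OwnDefect φ) cs ×
    (∀ v → ⋃ cs v ≡ false → count (λ u → ⋃ cs u ∧ H v u ∧ does (φ u ≟ᵇ c)) ≤ k * edges H (⋃ cs) (not ∘ Z))
  colour-pieces [] Z c _ _ _ = const c , (λ _ _ → refl) , (λ _ _ ()) , [] ,
    λ v _ → ≤-trans (≤-reflexive (count-empty {n} _ λ _ → refl)) z≤n
  colour-pieces (C ∷ cs) Z c (C# ∷ disj) ((C-cut , C-col) ∷ pieces) (C⊆Z ∷ inside)
    with colour-pieces cs Z c disj pieces inside
  ... | φ′ , real′ , boundary′ , own′ , few′ = φ , real , boundary , own , few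
    where
    leaving : ℕ
    leaving = edges H C (not ∘ Z)
    colourOf : ℕ → Bool
    colourOf zero    = not c
    colourOf (suc _) = c
    ψ : Fin n → Bool
    ψ = proj₁ (C-col (colourOf leaving))
    ψ-boundary : ∀ v u → C v ≡ true → C u ≡ false → H v u ≡ true → ψ v ≡ colourOf leaving
    ψ-boundary = proj₁ (proj₂ (C-col (colourOf leaving)))
    φ : Fin n → Bool
    φ v = if C v then ψ v else φ′ v
    φ-in : ∀ v → C v ≡ true → φ v ≡ ψ v
    φ-in v cv rewrite cv = refl
    φ-out : ∀ v → C v ≡ false → φ v ≡ φ′ v
    φ-out v cv rewrite cv = refl
    C#⋃ : Disjoint C (⋃ cs)
    C#⋃ v cv = ¬-not λ uv → let C′ , C′∈ , c′v = ⋃-elim cs uv in true≢false c′v (All.lookup C# C′∈ v cv)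
    real : ∀ v → C v ∨ ⋃ cs v ≡ false → φ v ≡ c
    real v e with C v | ⋃ cs v in uv
    real v e  | false | false = real′ v uv
    real v () | false | true
    real v () | true  | _
    boundary : ∀ v u → C v ∨ ⋃ cs v ≡ true → Z u ≡ false → H v u ≡ true → φ v ≡ c
    boundary v u e zu h = by (C v) refl
      where
      leaves : ∀ l → leaving ≡ l → C v ≡ true → colourOf l ≡ c
      leaves zero    l cv = ⊥-elim (edges-zero C (not ∘ Z) l v u cv h (cong not zu))
      leaves (suc _) l cv = refl
      by : ∀ b → C v ≡ b → φ v ≡ c
      by true  cv = trans (φ-in v cv) (trans (ψ-boundary v u cv (⊆-outside C⊆Z u zu) h) (leaves leaving refl cv))
      by false cv = trans (φ-out v cv) (boundary′ v u (subst (λ x → x ∨ ⋃ cs v ≡ true) cv e) zu h)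
    own : All (OwnDefect φ) (C ∷ cs)
    own = (λ v cv → ≤-trans (defect-mono {φ} {ψ} (λ _ e → e) φ-in v cv) (proj₂ (proj₂ (C-col (colourOf leaving))) v cv))
      ∷ All.tabulate λ {C′} C′∈ v c′v → ≤-trans
          (defect-mono {φ} {φ′} (λ _ e → e) (λ u c′u → φ-out u (¬-not λ cu → true≢false c′u (All.lookup C# C′∈ u cu))) v c′v)
          (All.lookup own′ C′∈ v c′v)
    few : ∀ v → C v ∨ ⋃ cs v ≡ false →
      count (λ u → (C u ∨ ⋃ cs u) ∧ H v u ∧ does (φ u ≟ᵇ c)) ≤ k * edges H (⋃ (C ∷ cs)) (not ∘ Z)
    few v e = begin
      count (λ u → (C u ∨ ⋃ cs u) ∧ H v u ∧ does (φ u ≟ᵇ c))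
        ≤⟨ count-∪ {P = λ u → C u ∧ H v u ∧ does (ψ u ≟ᵇ c)} {λ u → ⋃ cs u ∧ H v u ∧ does (φ′ u ≟ᵇ c)} split ⟩
      count (λ u → C u ∧ H v u ∧ does (ψ u ≟ᵇ c)) + count (λ u → ⋃ cs u ∧ H v u ∧ does (φ′ u ≟ᵇ c))
        ≤⟨ +-mono-≤ (in-C leaving refl) (few′ v uv) ⟩
      k * leaving + k * edges H (⋃ cs) (not ∘ Z)
        ≡⟨ sym (*-distribˡ-+ k leaving _) ⟩
      k * (leaving + edges H (⋃ cs) (not ∘ Z))
        ≤⟨ *-monoʳ-≤ k (edges-⊎ {C} {⋃ cs} (not ∘ Z) C#⋃) ⟩
      k * edges H (⋃ (C ∷ cs)) (not ∘ Z)
        ∎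
      where
      open ≤-Reasoning
      cv : C v ≡ false
      cv = ¬-not λ x → true≢false (∨-introˡ x) e
      uv : ⋃ cs v ≡ false
      uv = ¬-not λ x → true≢false (∨-introʳ (C v) x) e
      split : ∀ u → (C u ∨ ⋃ cs u) ∧ H v u ∧ does (φ u ≟ᵇ c) ≡ true →
        C u ∧ H v u ∧ does (ψ u ≟ᵇ c) ≡ true ⊎ ⋃ cs u ∧ H v u ∧ does (φ′ u ≟ᵇ c) ≡ true
      split u e with C u
      ... | true  = inj₁ e
      ... | false = inj₂ e
      -- If no edge leaves `Z` from `C`, the neighbours of `v` in `C` are boundary vertices of `C`
      -- and have the colour opposite to `c`. Otherwise the factor `suc l` pays for all of the at
      -- most `k` neighbours.
      in-C : ∀ l → leaving ≡ l → count (λ u → C u ∧ H v u ∧ does (ψ u ≟ᵇ c)) ≤ k * l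
      in-C zero l = ≤-trans (≤-reflexive (count-empty _ λ u → ¬-not λ e →
        let cu , e₁ = ∧-elim (C u) e ; h , s = ∧-elim (H v u) e₁ in
        not-¬ (does⇒ (ψ u ≟ᵇ c) s)
          (trans (ψ-boundary u v cu cv (trans (H-sym u v) h)) (cong colourOf l)))) z≤n
      in-C (suc l) _ = begin
        count (λ u → C u ∧ H v u ∧ does (ψ u ≟ᵇ c))
          ≤⟨ count-mono (λ u e → let cu , e₁ = ∧-elim (C u) e in ∧-intro cu (proj₁ (∧-elim (H v u) e₁))) ⟩
        count (λ u → C u ∧ H v u)   ≤⟨ neighbours-in≤cut C v cv ⟩
        cut H C                     ≤⟨ C-cut ⟩
        k                           ≤⟨ m≤m*n k (suc l) ⟩
        k * suc l                   ∎

  real : VSet n → List (VSet n) → VSet n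
  real Z cs v = Z v ∧ not (⋃ cs v)

  -- These are the cuts of the contraction, given by the side away from the complement of `Z`.
  Admissible : VSet n → List (VSet n) → VSet n → Set
  Admissible Z cs S = S ⊆ Z × All (Uniform S) cs

  -- A contraction of the graph: the members of cs and the complement of Z are contracted.
  record Contraction (Z : VSet n) (cs : List (VSet n)) : Set where
    field
      boundary  : cut H Z ≤ k
      disjoint  : AllPairs Disjoint cs
      pieces    : All Piece cs
      inside    : All (_⊆ Z) cs
      separated : ∀ a b → real Z cs a ≡ true → real Z cs b ≡ true → H a b ≡ true →
        ∃ λ S → Admissible Z cs S × S a ≡ not (S b) × cut H S ≤ k

  open Contraction

  -- All uncontracted vertices receive `c`. Their same-coloured neighbours lie outside `Z` or in
  -- pieces, where `colour-pieces` bounds them; vertices inside pieces keep the bound of their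
  -- piece.
  independent-colourable : ∀ {Z cs} → Contraction Z cs →
    (∀ a b → real Z cs a ≡ true → real Z cs b ≡ true → H a b ≡ true → ⊥) → Colourable Z
  independent-colourable {Z} {cs} K indep c
    with colour-pieces cs Z c (disjoint K) (pieces K) (inside K)
  ... | φ , φ-real , φ-boundary , φ-own , φ-few = φ , φ-out , φ-defect
    where
    φ-out : ∀ v u → Z v ≡ true → Z u ≡ false → H v u ≡ true → φ v ≡ c
    φ-out v u zv zu h = by (⋃ cs v) refl
      where
      by : ∀ b → ⋃ cs v ≡ b → φ v ≡ c
      by true  uv = φ-boundary v u uv zu h
      by false uv = φ-real v uv
    φ-defect : ∀ v → Z v ≡ true → defect φ Z v ≤ k + k * k
    φ-defect v zv = by (⋃ cs v) refl
      where
      open ≤-Reasoning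
      by : ∀ b → ⋃ cs v ≡ b → defect φ Z v ≤ k + k * k
      by true uv with C , C∈ , cv ← ⋃-elim cs uv =
        ≤-trans (defect-mono {φ} {φ} (All.lookup (inside K) C∈) (λ _ _ → refl) v cv) (All.lookup φ-own C∈ v cv)
      by false uv = begin
        defect φ Z v
          ≤⟨ count-∪ split ⟩
        count (λ u → H v u ∧ not (Z u)) + count (λ u → ⋃ cs u ∧ H v u ∧ does (φ u ≟ᵇ c))
          ≤⟨ +-mono-≤ (neighbours-out≤cut Z v zv) (φ-few v uv) ⟩
        cut H Z + k * edges H (⋃ cs) (not ∘ Z)
          ≤⟨ +-mono-≤ (boundary K) (*-monoʳ-≤ k (≤-trans pieces≤Z (boundary K))) ⟩
        k + k * k
          ∎
        where
        -- The edges that leave `Z` from the pieces are among the at most `k` edges leaving `Z`.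
        pieces≤Z : edges H (⋃ cs) (not ∘ Z) ≤ cut H Z
        pieces≤Z = edges-mono H H (⋃ cs) Z (not ∘ Z) (not ∘ Z) λ a b ua h zb →
          let C , C∈ , ca = ⋃-elim cs ua in ∧-intro (All.lookup (inside K) C∈ a ca) (∧-intro h zb)
        split : ∀ u → H v u ∧ (not (Z u) ∨ does (φ u ≟ᵇ φ v)) ≡ true →
          H v u ∧ not (Z u) ≡ true ⊎ ⋃ cs u ∧ H v u ∧ does (φ u ≟ᵇ c) ≡ true
        split u e with h , e₁ ← ∧-elim (H v u) e = by-Z (Z u) refl
          where
          by-⋃ : ∀ b → ⋃ cs u ≡ b → Z u ≡ true → ⋃ cs u ∧ H v u ∧ does (φ u ≟ᵇ c) ≡ true
          by-⋃ false uu zu = ⊥-elim (indep v u (∧-intro zv (cong not uv)) (∧-intro zu (cong not uu)) h)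
          by-⋃ true  uu zu = ∧-intro uu (∧-intro h (subst (λ x → does (φ u ≟ᵇ x) ≡ true) (φ-real v uv)
            (subst (λ z → not z ∨ does (φ u ≟ᵇ φ v) ≡ true) zu e₁)))
          by-Z : ∀ b → Z u ≡ b → H v u ∧ not (Z u) ≡ true ⊎ ⋃ cs u ∧ H v u ∧ does (φ u ≟ᵇ c) ≡ true
          by-Z false zu = inj₁ (∧-intro h (cong not zu))
          by-Z true  zu = inj₂ (by-⋃ (⋃ cs u) refl zu)

  Separator : VSet n → List (VSet n) → Fin n → Fin n → VSet n → Set
  Separator Z cs x y S = Admissible Z cs S × S x ≡ not (S y)

  separator? : ∀ Z cs x y S → Dec (Separator Z cs x y S)
  separator? Z cs x y S = (all? (λ v → (S v ≟ᵇ true) →-dec (Z v ≟ᵇ true)) ×-dec All.all? uniform? cs)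
    ×-dec (S x ≟ᵇ not (S y))
    where
    uniform? : ∀ C → Dec (Uniform S C)
    uniform? C = all? λ a → all? λ b → (C a ≟ᵇ true) →-dec ((C b ≟ᵇ true) →-dec (S a ≟ᵇ S b))

  separator-resp : ∀ {Z cs x y S S′} → S ≗ S′ → Separator Z cs x y S → Separator Z cs x y S′
  separator-resp {x = x} {y} h ((S⊆Z , uni) , sep) =
    ((λ v e → S⊆Z v (trans (h v) e)) ,
     All.map (λ u a b ca cb → trans (sym (h a)) (trans (u a b ca cb) (h b))) uni) ,
    trans (sym (h x)) (trans sep (cong not (h y)))

  uniform-map₂ : ∀ (f : Bool → Bool → Bool) {S R : VSet n} (cs : List (VSet n)) → All (Uniform S) cs → All (Uniform R) cs →
    All (Uniform (λ v → f (S v) (R v))) cs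
  uniform-map₂ f cs uS uR = All.zipWith (λ (s , r) a b ca cb → cong₂ f (s a b ca cb) (r a b ca cb)) (uS , uR)

  -- Gomory–Hu step: contract either side of a minimum cut A between x and y. A small cut S
  -- separating two vertices on one side of A is uncrossed from A by replacing it with one of
  -- S ∪ A, S ∖ A, S ∩ A, A ∖ S.
  module Split {Z cs} (K : Contraction Z cs) (x y : Fin n)
    (x-real : real Z cs x ≡ true) (y-real : real Z cs y ≡ true)
    (A : VSet n) (A-adm : Admissible Z cs A) (ax : A x ≡ true) (ay : A y ≡ false) (A-cut : cut H A ≤ k)
    (A-min : ∀ S → Separator Z cs x y S → cut H A ≤ cut H S) where

    -- Since `A` splits no piece, a piece that meets `A` lies inside it, so the two filters sort the
    -- pieces by the sides of `A`.
    Meets : VSet n → Set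
    Meets C = ∃ λ v → C v ∧ A v ≡ true

    meets? : ∀ C → Dec (Meets C)
    meets? C = any? λ v → C v ∧ A v ≟ᵇ true

    misses? : ∀ C → Dec (¬ Meets C)
    misses? C = ¬? (meets? C)

    cs-in cs-out : List (VSet n)
    cs-in  = filter meets? cs
    cs-out = filter misses? cs

    Z∖⋃ : ∀ {Z′ cs′} v → real Z′ cs′ v ≡ true → Z′ v ≡ true × ⋃ cs′ v ≡ false
    Z∖⋃ {Z′} v e with z , u ← ∧-elim (Z′ v) e = z , not-false u

    real-in⇒real : ∀ v → real A cs-in v ≡ true → real Z cs v ≡ true
    real-in⇒real v e with av , uv ← Z∖⋃ {A} {cs-in} v e =
      ∧-intro (proj₁ A-adm v av) (cong not (¬-not λ u → let C , C∈ , cv = ⋃-elim cs u in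
        true≢false (⋃-intro (∈-filter⁺ meets? C∈ (v , ∧-intro cv av)) cv) uv))

    real-out⇒real : ∀ v → real Z (A ∷ cs-out) v ≡ true → real Z cs v ≡ true × A v ≡ false
    real-out⇒real v e with zv , uv ← Z∖⋃ {Z} {A ∷ cs-out} v e =
      ∧-intro zv (cong not (¬-not not-in-⋃)) , av
      where
      av : A v ≡ false
      av = ¬-not λ a → true≢false (∨-introˡ a) uv
      not-in-⋃ : ⋃ cs v ≢ true
      not-in-⋃ u with C , C∈ , cv ← ⋃-elim cs u with meets? C
      ... | yes (w , e) with cw , aw ← ∧-elim (C w) e =
            true≢false (trans (All.lookup (proj₂ A-adm) C∈ v w cv cw) aw) av
      ... | no ¬m = true≢false (∨-introʳ (A v) (⋃-intro (∈-filter⁺ misses? C∈ ¬m) cv)) uv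

    -- One corner of the crossing of `S` and `A` still separates `x` from `y`, so minimality of `A`
    -- bounds its cut from below; uncrossing then bounds the complementary corner by the cut of `S`.
    combined : ∀ (f : Bool → Bool → Bool) {S} → Admissible Z cs S →
      (∀ s a → f s a ≡ true → s ≡ true ⊎ a ≡ true) → f (S x) true ≡ not (f (S y) false) →
      cut H A ≤ cut H (λ v → f (S v) (A v))
    combined f {S} (S⊆Z , uni) f-⊆ sep = A-min (λ v → f (S v) (A v))
      ((within-Z , uniform-map₂ f cs uni (proj₂ A-adm)) ,
        subst₂ (λ a b → f (S x) a ≡ not (f (S y) b)) (sym ax) (sym ay) sep)
      where
      within-Z : (λ v → f (S v) (A v)) ⊆ Z
      within-Z v e with f-⊆ (S v) (A v) e
      ... | inj₁ s = S⊆Z v s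
      ... | inj₂ a = proj₁ A-adm v a

    inter diff diff′ union : VSet n → VSet n
    inter S v = S v ∧ A v
    diff  S v = S v ∧ not (A v)
    diff′ S v = A v ∧ not (S v)
    union S v = S v ∨ A v

    cancel : ∀ {p q r s} → p + q ≤ r + s → s ≤ q → p ≤ r
    cancel {p} {q} {r} {s} h s≤q = +-cancelʳ-≤ s p r (≤-trans (+-monoʳ-≤ p s≤q) h)

    cancelˡ : ∀ {p q r s} → p + q ≤ r + s → s ≤ p → q ≤ r
    cancelˡ {p} {q} h = cancel (≤-trans (≤-reflexive (+-comm q p)) h)

    -- The usable corner is the one whose companion separates `x` from `y`: inside `A` this depends
    -- on the side of `y`, outside `A` on the side of `x`.
    module Uncross {S} (S-adm : Admissible Z cs S) where

      S⊆Z = proj₁ S-adm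
      S-uni = proj₂ S-adm

      inter-cut : S y ≡ false → cut H (inter S) ≤ cut H S
      inter-cut sy = cancel (cut-submodular H S A)
        (combined _∨_ S-adm (λ s a → ∨-elim s) (separates (S x) sy))
        where
        separates : ∀ s {t} → t ≡ false → s ∨ true ≡ not (t ∨ false)
        separates true  refl = refl
        separates false refl = refl

      diff′-cut : S y ≡ true → cut H (diff′ S) ≤ cut H S
      diff′-cut sy = cancelˡ (cut-posimodular H H-sym S A)
        (combined (λ s a → s ∧ not a) S-adm (λ s a e → inj₁ (proj₁ (∧-elim s e))) (separates (S x) sy))
        where
        separates : ∀ s {t} → t ≡ true → s ∧ false ≡ not (t ∧ true)
        separates true  refl = refl
        separates false refl = refl

      union-cut : S x ≡ true → cut H (union S) ≤ cut H S
      union-cut sx = cancelˡ (cut-submodular H S A)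
        (combined _∧_ S-adm (λ s a e → inj₁ (proj₁ (∧-elim s e))) (separates (S y) sx))
        where
        separates : ∀ t {s} → s ≡ true → s ∧ true ≡ not (t ∧ false)
        separates true  refl = refl
        separates false refl = refl

      diff-cut : S x ≡ false → cut H (diff S) ≤ cut H S
      diff-cut sx = cancel (cut-posimodular H H-sym S A)
        (combined (λ s a → a ∧ not s) S-adm (λ s a e → inj₂ (proj₁ (∧-elim a e))) (separates (S y) sx))
        where
        separates : ∀ t {s} → s ≡ false → true ∧ not s ≡ not (false ∧ not t)
        separates t refl = refl

    inner : Contraction A cs-in
    inner = record
      { boundary  = A-cut
      ; disjoint  = AllPairs.filter⁺ meets? (disjoint K)
      ; pieces    = All.filter⁺ meets? (pieces K)
      ; inside    = All.zipWith (λ ((w , e) , uni) a ca → let cw , aw = ∧-elim _ e in trans (uni a w ca cw) aw)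
                      (All.all-filter meets? cs , All.filter⁺ meets? (proj₂ A-adm))
      ; separated = sep
      }
      where
      sep : ∀ a b → real A cs-in a ≡ true → real A cs-in b ≡ true → H a b ≡ true →
        ∃ λ S → Admissible A cs-in S × S a ≡ not (S b) × cut H S ≤ k
      sep a b ra rb h with separated K a b (real-in⇒real a ra) (real-in⇒real b rb) h
      ... | S , S-adm , ab , S-cut = by (S y) refl
        where
        open Uncross S-adm
        aa = proj₁ (Z∖⋃ {A} {cs-in} a ra)
        Ab = proj₁ (Z∖⋃ {A} {cs-in} b rb)
        by : ∀ c → S y ≡ c → ∃ λ S → Admissible A cs-in S × S a ≡ not (S b) × cut H S ≤ k
        by false sy = inter S ,
          ((λ v e → proj₂ (∧-elim (S v) e)) , All.filter⁺ meets? (uniform-map₂ _∧_ cs S-uni (proj₂ A-adm))) ,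
          flip-∩ (S a) (S b) aa Ab ab , ≤-trans (inter-cut sy) S-cut
          where
          flip-∩ : ∀ s t {a b} → a ≡ true → b ≡ true → s ≡ not t → s ∧ a ≡ not (t ∧ b)
          flip-∩ _ true  refl refl refl = refl
          flip-∩ _ false refl refl refl = refl
        by true sy = diff′ S ,
          ((λ v e → proj₁ (∧-elim (A v) e)) ,
            All.filter⁺ meets? (uniform-map₂ (λ s a → a ∧ not s) cs S-uni (proj₂ A-adm))) ,
          flip-∖ (S a) (S b) aa Ab ab , ≤-trans (diff′-cut sy) S-cut
          where
          flip-∖ : ∀ s t {a b} → a ≡ true → b ≡ true → s ≡ not t → a ∧ not s ≡ not (b ∧ not t)
          flip-∖ _ true  refl refl refl = refl
          flip-∖ _ false refl refl refl = refl

    outer : Colourable A → Contraction Z (A ∷ cs-out)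
    outer A-col = record
      { boundary  = boundary K
      ; disjoint  = All.map missed (All.all-filter misses? cs) ∷ AllPairs.filter⁺ misses? (disjoint K)
      ; pieces    = (A-cut , A-col) ∷ All.filter⁺ misses? (pieces K)
      ; inside    = proj₁ A-adm ∷ All.filter⁺ misses? (inside K)
      ; separated = sep
      }
      where
      missed : ∀ {C} → ¬ Meets C → Disjoint A C
      missed ¬m v av = ¬-not λ cv → ¬m (v , ∧-intro cv av)
      sep : ∀ a b → real Z (A ∷ cs-out) a ≡ true → real Z (A ∷ cs-out) b ≡ true → H a b ≡ true →
        ∃ λ S → Admissible Z (A ∷ cs-out) S × S a ≡ not (S b) × cut H S ≤ k
      sep a b ra rb h with ra′ , aa ← real-out⇒real a ra | rb′ , Ab ← real-out⇒real b rb
        with separated K a b ra′ rb′ h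
      ... | S , S-adm , ab , S-cut = by (S x) refl
        where
        open Uncross S-adm
        by : ∀ c → S x ≡ c → ∃ λ S → Admissible Z (A ∷ cs-out) S × S a ≡ not (S b) × cut H S ≤ k
        -- This replacement contains all of `A` and the one in the other case none of it, so both
        -- remain cuts after `A` is contracted.
        by true sx = union S ,
          ((λ v e → [ S⊆Z v , proj₁ A-adm v ]′ (∨-elim (S v) e)) ,
            (λ u w au aw → trans (∨-introʳ (S u) au) (sym (∨-introʳ (S w) aw)))
            ∷ All.filter⁺ misses? (uniform-map₂ _∨_ cs S-uni (proj₂ A-adm))) ,
          flip-∪ (S a) (S b) aa Ab ab , ≤-trans (union-cut sx) S-cut
          where
          flip-∪ : ∀ s t {a b} → a ≡ false → b ≡ false → s ≡ not t → s ∨ a ≡ not (t ∨ b)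
          flip-∪ _ true  refl refl refl = refl
          flip-∪ _ false refl refl refl = refl
        by false sx = diff S ,
          ((λ v e → S⊆Z v (proj₁ (∧-elim (S v) e))) ,
            (λ u w au aw → trans (emptied (S u) au) (sym (emptied (S w) aw)))
            ∷ All.filter⁺ misses? (uniform-map₂ (λ s a → s ∧ not a) cs S-uni (proj₂ A-adm))) ,
          flip-∖ (S a) (S b) aa Ab ab , ≤-trans (diff-cut sx) S-cut
          where
          emptied : ∀ s {a} → a ≡ true → s ∧ not a ≡ false
          emptied s refl = ∧-zeroʳ s
          flip-∖ : ∀ s t {a b} → a ≡ false → b ≡ false → s ≡ not t → s ∧ not a ≡ not (t ∧ not b)
          flip-∖ _ true  refl refl refl = refl
          flip-∖ _ false refl refl refl = refl

    inner-smaller : count (real A cs-in) < count (real Z cs)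
    inner-smaller = count-< y real-in⇒real (∧-zero ay) y-real

    outer-smaller : count (real Z (A ∷ cs-out)) < count (real Z cs)
    outer-smaller = count-< x (λ v → proj₁ ∘ real-out⇒real v)
      (subst (λ a → Z x ∧ not (a ∨ ⋃ cs-out x) ≡ false) (sym ax) (∧-zeroʳ (Z x))) x-real

  -- Induction on the number of uncontracted vertices: `inner` loses the end of the edge outside
  -- `A`, and `outer` absorbs the other end into the piece `A`. Colouring `A` first is what makes it
  -- a piece.
  colourable : ∀ m {Z cs} → Contraction Z cs → count (real Z cs) < m → Colourable Z
  colourable (suc m) {Z} {cs} K (s≤s size)
    with any? (λ a → any? λ b → (real Z cs a ≟ᵇ true) ×-dec (real Z cs b ≟ᵇ true) ×-dec (H a b ≟ᵇ true))
  ... | no none = independent-colourable K λ a b ra rb h → none (a , b , ra , rb , h)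
  ... | yes (x , y , rx , ry , h) with separated K x y rx ry h
  ...   | S , S-adm , xy , S-cut
    with least {P = Separator Z cs x y} separator-resp (separator? Z cs x y) H (suc (cut H S)) S (S-adm , xy) ≤-refl
  ...     | A , (A-adm , A-xy) , A≤S , A-min = by (A x) (A y) refl refl
    where
    A-cut : cut H A ≤ k
    A-cut = ≤-trans A≤S S-cut
    by : ∀ c d → A x ≡ c → A y ≡ d → Colourable Z
    by true false ax ay = colourable m (outer (colourable m inner (≤-trans inner-smaller size))) (≤-trans outer-smaller size)
      where open Split K x y rx ry A A-adm ax ay A-cut A-min
    -- Here `A` contains `y`, so the roles of `x` and `y` are exchanged; minimality carries over
    -- because separating them is a symmetric condition.
    by false true ax ay = colourable m (outer (colourable m inner (≤-trans inner-smaller size))) (≤-trans outer-smaller size)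
      where
      A-min′ : ∀ S → Separator Z cs y x S → cut H A ≤ cut H S
      A-min′ S (adm , e) = A-min S (adm , trans (sym (not-involutive (S x))) (cong not (sym e)))
      open Split K y x ry rx A A-adm ay ax A-cut A-min′
    by true  true  ax ay = ⊥-elim (true≢false ax (trans A-xy (cong not ay)))
    by false false ax ay = ⊥-elim (true≢false (trans A-xy (cong not ay)) ax)

  small-cuts-colouring : (∀ a b → H a b ≡ true → ∃ λ S → S a ≡ true × S b ≡ false × cut H S ≤ k) →
    ∃ λ (φ : Fin n → Bool) → ∀ v → count (λ u → H v u ∧ does (φ u ≟ᵇ φ v)) ≤ k + k * k
  small-cuts-colouring small = proj₁ col , λ v → proj₂ (proj₂ col) v refl
    where
    whole : Contraction (const true) []
    whole = record
      { boundary  = ≤-trans (≤-reflexive (sum-zero {n} _ λ a → sum-zero {n} _ λ b → cong ι (∧-zeroʳ (H a b)))) z≤n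
      ; disjoint  = []
      ; pieces    = []
      ; inside    = []
      ; separated = λ a b _ _ h → let S , sa , sb , c = small a b h in
          S , ((λ _ _ → refl) , []) , trans sa (cong not (sym sb)) , c
      }
    -- Nothing lies outside the whole vertex set, so the prescribed boundary colour `true` is
    -- arbitrary.
    col = colourable (suc (count (real (const true) []))) whole ≤-refl true

-- Combining weak and strong edges.

bool→Fin : Bool → Fin 2
bool→Fin true  = zero
bool→Fin false = suc zero

bool→Fin-injective : ∀ {a b} → bool→Fin a ≡ bool→Fin b → a ≡ b
bool→Fin-injective {true}  {true}  _ = refl
bool→Fin-injective {false} {false} _ = refl

length-filter-tabulate : ∀ {A : Set} {P : A → Set} (P? : ∀ x → Dec (P x)) (f : Fin n → A) →
  length (filter P? (List.tabulate f)) ≡ count (does ∘ P? ∘ f)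
length-filter-tabulate {zero}  P? f = refl
length-filter-tabulate {suc n} P? f with does (P? (f zero))
... | true  = cong suc (length-filter-tabulate P? (f ∘ suc))
... | false = length-filter-tabulate P? (f ∘ suc)

theorem32 : ∀ (t : ℕ) → ∃ λ (d : ℕ) →
    ∀ (G : Graph) → ¬ StrongImmersionK t G → ColourableWithDefect G 2 d
-- `K + K * K` bounds the same-coloured neighbours along weak edges, and `large` bounds all strong
-- neighbours whatever their colour.
theorem32 t = (K + K * K) + large , bounded
  where
  K large : ℕ
  K     = t * t
  large = t * suc (t * t + t * t)
  bounded : ∀ (G : Graph) → ¬ StrongImmersionK t G → ColourableWithDefect G 2 ((K + K * K) + large)
  bounded G no-immersion = bool→Fin ∘ φ , defect-bound
    where
    V = Vertex G
    A = adj G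
    SmallCut : V → V → VSet (size G) → Set
    SmallCut a b S = S a ≡ true × S b ≡ false × cut A S < K
    smallCut? : ∀ a b → Dec (∃ (SmallCut a b))
    smallCut? a b = someSet?
      (λ h (x , y , c) → trans (sym (h a)) x , trans (sym (h b)) y , subst (_< K) (cut-cong A h) c)
      (λ S → (S a ≟ᵇ true) ×-dec (S b ≟ᵇ false) ×-dec (cut A S <ⁿ? K))
    complement : ∀ {a b} → ∃ (SmallCut a b) → ∃ (SmallCut b a)
    complement (S , x , y , c) = not ∘ S , cong not y , cong not x ,
      subst (_< K) (sym (cut-complement A (Graph.sym G) S)) c
    weak? : V → V → Bool
    weak? a b = does (smallCut? a b)
    weak?-sym : ∀ a b → weak? a b ≡ weak? b a
    weak?-sym a b = does-⇔ (mk⇔ complement complement) (smallCut? a b) (smallCut? b a)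
    H : Arcs (size G)
    H a b = A a b ∧ weak? a b
    H-sym : ∀ a b → H a b ≡ H b a
    H-sym a b = cong₂ _∧_ (Graph.sym G a b) (weak?-sym a b)
    -- A small cut of `G` is also small in its subgraph `H` of weak edges.
    colouring = SmallCuts.small-cuts-colouring H H-sym K λ a b h →
      let S , sa , sb , c = does⇒ (smallCut? a b) (proj₂ (∧-elim (A a b) h)) in
      S , sa , sb , ≤-trans (cut-⊑ (λ a b → proj₁ ∘ ∧-elim (A a b)) S) (<⇒≤ c)
    φ : V → Bool
    φ = proj₁ colouring
    strong : V → VSet (size G)
    strong v u = A v u ∧ not (weak? v u)
    few-strong : ∀ v → count (strong v) ≤ large
    -- A cut of size less than `K` around `u` avoiding `v` would, after complementation, make the
    -- edge between `v` and `u` weak.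
    few-strong v = ≮⇒≥ λ lt → no-immersion (many-strong-neighbours⇒immersion G t v (strong v)
      (λ u e → let d , w = ∧-elim (A v u) e in trans (Graph.sym G u v) d ,
        λ S sv su → ≮⇒≥ λ c → true≢false
          (dec-true (smallCut? v u) (complement (S , su , sv , c))) (not-false w))
      (<⇒≤ lt))
    defect-bound : ∀ v → sameColourNbrs G (bool→Fin ∘ φ) v ≤ (K + K * K) + large
    defect-bound v = begin
      sameColourNbrs G (bool→Fin ∘ φ) v
        ≡⟨ length-filter-tabulate (λ u → T? (A v u) ×-dec (bool→Fin (φ u) ≟ bool→Fin (φ v))) (λ u → u) ⟩
      count (λ u → A v u ∧ does (bool→Fin (φ u) ≟ bool→Fin (φ v)))
        ≤⟨ count-∪ classify ⟩
      count (λ u → H v u ∧ does (φ u ≟ᵇ φ v)) + count (strong v)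
        ≤⟨ +-mono-≤ (proj₂ colouring v) (few-strong v) ⟩
      (K + K * K) + large
        ∎
      where
      open ≤-Reasoning
      classify : ∀ u → A v u ∧ does (bool→Fin (φ u) ≟ bool→Fin (φ v)) ≡ true →
        H v u ∧ does (φ u ≟ᵇ φ v) ≡ true ⊎ strong v u ≡ true
      classify u e with d , s ← ∧-elim (A v u) e = by (weak? v u) refl
        where
        by : ∀ w → weak? v u ≡ w → H v u ∧ does (φ u ≟ᵇ φ v) ≡ true ⊎ strong v u ≡ true
        by true  w = inj₁ (∧-intro (∧-intro d w)
          (dec-true (φ u ≟ᵇ φ v) (bool→Fin-injective (does⇒ (bool→Fin (φ u) ≟ bool→Fin (φ v)) s))))
        by false w = inj₂ (∧-intro d (cong not w))
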